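{- For every $v\equiv 0,6,12 \pmod{24}$ with $v\ge 12$, there exists a $2$-split decomposition of $K_v^{(3)}-I$ into tight $6$-cycles.
   Context: $K_v^{(3)}$ denotes the complete $3$-uniform hypergraph on $v$ vertices; for $3\mid v$, $K_v^{(3)}-I$ is obtained by deleting the edges of a $1$-factor $I$ (a set of $v/3$ pairwise disjoint triples covering all vertices). A (3-uniform tight) $k$-cycle is given by a cyclic sequence $v_1,\dots,v_k$ of $k$ distinct vertices, its edges being the triples $\{v_i,v_{i+1},v_{i+2}\}$ ($i=1,\dots,k$, indices mod $k$). A decomposition is a collection of cycles whose edge sets partition the edge set. For even $v$ with $3\mid v/2$, a $2$-split decomposition of $K_v^{(3)}-I$ into $k$-cycles is one where the vertex set is partitioned into two sets $V_1,V_2$ of size $v/2$, the $1$-factor is $I=I_1\cup I_2$ with $I_j$ a $1$-factor of $V_j$, and the collection of cycles consists of a $k$-cycle decomposition of $K^{(3)}[V_1]-I_1$, a $k$-cycle decomposition of $K^{(3)}[V_2]-I_2$, and a $k$-cycle decomposition of the hypergraph of all triples meeting both $V_1$ and $V_2$. -}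

module Defs where

open import Data.Fin using (Fin; toℕ)
open import Data.Fin.Subset using (Subset; ⊤; ⁅_⁆; _∩_; _∪_; _⊆_; ⋃; ∣_∣; Empty; Nonempty)
open import Data.List using (List; _++_)
import Data.List.Membership.Propositional as List
open import Data.List.Relation.Binary.Permutation.Propositional using (_↭_)
open import Data.List.Relation.Unary.All using (All)
open import Data.List.Relation.Unary.AllPairs using (AllPairs)
open import Data.List.Relation.Unary.Any using (Any)
open import Data.Nat using (ℕ; NonZero; _+_; _/_)
open import Data.Nat.DivMod using (_mod_)
open import Data.Product using (∃-syntax; _×_)
open import Function.Definitions using (Injective)
open import Level using (0ℓ)
open import Relation.Binary.PropositionalEquality using (_≡_)
open import Relation.Unary using (Pred)
import Relation.Unary as Pred

-- A hypergraph on the vertex set Fin v is given by its set of edges.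
Hypergraph : ℕ → Set₁
Hypergraph v = Pred (Subset v) 0ℓ

-- K⁽³⁾[W]; the complete hypergraph K_v⁽³⁾ is K³[ ⊤ ].
K³[_] : ∀ {v} → Subset v → Hypergraph v
K³[ W ] e = ∣ e ∣ ≡ 3 × e ⊆ W

_without_ : ∀ {v} → Hypergraph v → List (Subset v) → Hypergraph v
(H without I) e = H e × e List.∉ I

Crossing : ∀ {v} → Subset v → Subset v → Hypergraph v
Crossing V₁ V₂ e = ∣ e ∣ ≡ 3 × Nonempty (e ∩ V₁) × Nonempty (e ∩ V₂)

-- The triples are nonempty and pairwise disjoint, so the list has no
-- repetitions and represents a set of triples.
record IsOneFactor {v : ℕ} (W : Subset v) (I : List (Subset v)) : Set where
  field
    triples  : All (λ e → ∣ e ∣ ≡ 3) I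
    disjoint : AllPairs (λ e f → Empty (e ∩ f)) I
    covers   : ⋃ I ≡ W

record Cycle (k v : ℕ) : Set where
  field
    vertex   : Fin k → Fin v
    distinct : Injective _≡_ _≡_ vertex

module _ {k v : ℕ} .{{_ : NonZero k}} where

  edge : Cycle k v → Fin k → Subset v
  edge C i = ⁅ vertex i ⁆ ∪ ⁅ vertex ((toℕ i + 1) mod k) ⁆ ∪ ⁅ vertex ((toℕ i + 2) mod k) ⁆
    where open Cycle C

  edges : Cycle k v → Hypergraph v
  edges C e = ∃[ i ] e ≡ edge C i

  record IsDecomposition (H : Hypergraph v) (Cs : List (Cycle k v)) : Set where
    field
      contained : All (λ C → edges C Pred.⊆ H) Cs
      disjoint  : AllPairs (λ C D → edges C Pred.⊥ edges D) Cs
      covers    : ∀ e → H e → Any (λ C → edges C e) Cs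

  -- Lists stand for unordered collections, hence the use of _↭_.
  record IsTwoSplitDecomposition (I : List (Subset v)) (Cs : List (Cycle k v)) : Set where
    field
      isOneFactor     : IsOneFactor ⊤ I
      isDecomposition : IsDecomposition (K³[ ⊤ ] without I) Cs

      V₁ V₂    : Subset v
      disjoint : Empty (V₁ ∩ V₂)
      covers   : V₁ ∪ V₂ ≡ ⊤
      size₁    : ∣ V₁ ∣ ≡ v / 2
      size₂    : ∣ V₂ ∣ ≡ v / 2

      I₁ I₂        : List (Subset v)
      isOneFactor₁ : IsOneFactor V₁ I₁
      isOneFactor₂ : IsOneFactor V₂ I₂
      I-split      : I ↭ I₁ ++ I₂

      Cs₁ Cs₂ Cs₁₂      : List (Cycle k v)
      isDecomposition₁  : IsDecomposition (K³[ V₁ ] without I₁) Cs₁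
      isDecomposition₂  : IsDecomposition (K³[ V₂ ] without I₂) Cs₂
      isDecomposition₁₂ : IsDecomposition (Crossing V₁ V₂) Cs₁₂
      Cs-split          : Cs ↭ Cs₁ ++ Cs₂ ++ Cs₁₂

{-# OPTIONS --safe #-}
module Submission where

open import Defs
open import Algebra using (CommutativeSemiring)
open import Algebra.Structures using (IsCommutativeMonoid)
open import Algebra.Structures.Biased using (isCommutativeSemiringˡ; isCommutativeMonoidˡ)
import Algebra.Solver.Ring.NaturalCoefficients.Default as SemiringSolver
import Data.Bool.Properties as Bool
open import Data.Fin using (Fin; zero; suc; toℕ; #_; combine; quotient; remainder)
import Data.Fin.Properties as Fin
open import Data.Fin.Subset using (Subset; inside; outside; ⊥; ⊤; ⁅_⁆; _∪_; _∩_; _-_; ⋃; _∈_; _∉_; _⊆_; ∣_∣; Empty; Nonempty)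
open import Data.Fin.Subset.Properties
open import Data.List using (List; []; _∷_; [_]; map; _++_; length; allFin; take; drop; cartesianProductWith)
import Data.List.Properties as List
import Data.List.Membership.Propositional as List
import Data.List.Membership.DecPropositional as DecMembership
open import Data.List.Membership.Propositional.Properties using (∈-map⁺; ∈-map⁻; ∈-++⁺ˡ; ∈-++⁺ʳ; ∈-++⁻; ∈-allFin; ∈-cartesianProductWith⁺; ∈-cartesianProductWith⁻)
open import Data.List.Relation.Binary.Disjoint.Propositional using (Disjoint)
open import Data.List.Relation.Binary.Permutation.Propositional using (_↭_; ↭-refl; ↭-sym; ↭-trans; ↭-reflexive; ↭⇒↭ₛ; prep; module PermutationReasoning)
import Data.List.Relation.Binary.Permutation.Propositional.Properties as Perm
import Data.List.Relation.Binary.Permutation.Setoid.Properties as PermSetoid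
open import Data.List.Relation.Unary.All as All using (All; []; _∷_)
import Data.List.Relation.Unary.All.Properties as All
open import Data.List.Relation.Unary.AllPairs as AllPairs using (AllPairs; []; _∷_)
import Data.List.Relation.Unary.AllPairs.Properties as AllPairs
open import Data.List.Relation.Unary.Any as Any using (Any; here; there)
import Data.List.Relation.Unary.Any.Properties as Any
open import Data.List.Relation.Unary.Unique.Propositional using (Unique)
import Data.List.Relation.Unary.Unique.Propositional.Properties as Unique
open import Data.Nat using (ℕ; zero; suc; _+_; _*_; _∸_; _⊓_; _/_; _%_; _≤_; _<_; z≤n; s≤s; NonZero)
open import Data.Nat.DivMod using (_mod_; m≡m%n+[m/n]*n; m*n/n≡m)
import Data.Nat.Properties as ℕ
open import Data.Nat.Tactic.RingSolver using (solve-∀)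
open import Data.Product using (_×_; _,_; ∃-syntax; Σ-syntax; proj₁; proj₂)
open import Data.Sum using (_⊎_; inj₁; inj₂; [_,_]′; swap)
open import Data.Vec using (Vec; []; _∷_; lookup; tabulate; here; there)
open import Data.Vec.Properties using (≡-dec; []=⇒lookup; lookup⇒[]=; lookup∘tabulate)
open import Data.Vec.Relation.Unary.All as VecAll using ([]; _∷_)
import Data.Vec.Relation.Unary.All.Properties as VecAll
open import Data.Vec.Relation.Unary.AllPairs using ([]; _∷_)
open import Data.Vec.Relation.Unary.Unique.Propositional using () renaming (Unique to UniqueVec)
import Data.Vec.Relation.Unary.Unique.Propositional.Properties as UniqueVec
open import Function using (_∘_)
open import Function.Definitions using (Injective)
open import Relation.Binary using (DecidableEquality)
open import Relation.Binary.PropositionalEquality hiding ([_])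
open import Relation.Nullary using (Dec; ¬_; yes; no; contradiction)
open import Relation.Nullary.Decidable using (True; toWitness; decidable-stable; _×-dec_; _→-dec_; ¬?)
open import Relation.Unary using (_≐_)
import Relation.Unary as Pred

-- The vertices are split into groups of three, v = 3 · 2t, and I is the set of
-- groups. A triple outside I meets two or three groups; call the set of groups
-- it meets its shadow. The 18 triples with a given shadow {g, h} form three
-- tight 6-cycles, and the 54 triples whose shadow is {g, h, i} or {g, h, j}
-- form nine (a decomposition of the complete tripartite hypergraph K_{3,3,6}).
-- It remains to pair up 3-subsets of groups so that paired subsets share two
-- groups, separately inside the two halves of t groups and across them; this
-- is possible since t ≡ 0, 1, 2 (mod 4). Such a pairing is an identity between
-- elementary symmetric polynomials: e₃ (or e₁e₂, across the halves) has to be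
-- a sum of terms gh(i + j). This follows by adding four groups at a time, or,
-- for e₁e₂ with t even, by pairing the groups in the factor e₁.

private
  variable
    k l m n : ℕ

-- Cardinalities of finite subsets.

∣p∪q∣≤∣p∣+∣q∣ : (p q : Subset n) → ∣ p ∪ q ∣ ≤ ∣ p ∣ + ∣ q ∣
∣p∪q∣≤∣p∣+∣q∣ []            []            = z≤n
∣p∪q∣≤∣p∣+∣q∣ (outside ∷ p) (outside ∷ q) = ∣p∪q∣≤∣p∣+∣q∣ p q
∣p∪q∣≤∣p∣+∣q∣ (outside ∷ p) (inside ∷ q)  =
  ℕ.≤-trans (s≤s (∣p∪q∣≤∣p∣+∣q∣ p q)) (ℕ.≤-reflexive (sym (ℕ.+-suc ∣ p ∣ ∣ q ∣)))
∣p∪q∣≤∣p∣+∣q∣ (inside ∷ p)  (y ∷ q)       =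
  s≤s (ℕ.≤-trans (∣p∪q∣≤∣p∣+∣q∣ p q) (ℕ.+-monoʳ-≤ ∣ p ∣ (∣p∣≤∣x∷p∣ y q)))

disjoint⇒∣p∪q∣≡∣p∣+∣q∣ : (p q : Subset n) → Empty (p ∩ q) → ∣ p ∪ q ∣ ≡ ∣ p ∣ + ∣ q ∣
disjoint⇒∣p∪q∣≡∣p∣+∣q∣ []            []            _ = refl
disjoint⇒∣p∪q∣≡∣p∣+∣q∣ (outside ∷ p) (outside ∷ q) d = disjoint⇒∣p∪q∣≡∣p∣+∣q∣ p q (drop-∷-Empty d)
disjoint⇒∣p∪q∣≡∣p∣+∣q∣ (outside ∷ p) (inside ∷ q)  d =
  trans (cong suc (disjoint⇒∣p∪q∣≡∣p∣+∣q∣ p q (drop-∷-Empty d))) (sym (ℕ.+-suc ∣ p ∣ ∣ q ∣))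
disjoint⇒∣p∪q∣≡∣p∣+∣q∣ (inside ∷ p)  (outside ∷ q) d =
  cong suc (disjoint⇒∣p∪q∣≡∣p∣+∣q∣ p q (drop-∷-Empty d))
disjoint⇒∣p∪q∣≡∣p∣+∣q∣ (inside ∷ p)  (inside ∷ q)  d = contradiction (zero , here) d

x∉p⇒∣⁅x⁆∪p∣≡1+∣p∣ : {x : Fin n} {p : Subset n} → x ∉ p → ∣ ⁅ x ⁆ ∪ p ∣ ≡ suc ∣ p ∣
x∉p⇒∣⁅x⁆∪p∣≡1+∣p∣ {x = x} {p} x∉p = trans
  (disjoint⇒∣p∪q∣≡∣p∣+∣q∣ ⁅ x ⁆ p λ (y , y∈) → let y∈x , y∈p = x∈p∩q⁻ ⁅ x ⁆ p y∈ in
    x∉p (subst (_∈ p) (x∈⁅y⁆⇒x≡y x y∈x) y∈p))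
  (cong (_+ ∣ p ∣) (∣⁅x⁆∣≡1 x))

p⊆q∧∣q∣≤∣p∣⇒p≡q : {p q : Subset n} → p ⊆ q → ∣ q ∣ ≤ ∣ p ∣ → p ≡ q
p⊆q∧∣q∣≤∣p∣⇒p≡q {p = p} {q} p⊆q q≤p = ⊆-antisym p⊆q λ {x} x∈q → decidable-stable (x ∈? p) λ x∉p →
    ℕ.<⇒≱ (p⊂q⇒∣p∣<∣q∣ (p⊆q , x , x∈q , x∉p)) q≤p

x∈p⇒⁅x⁆⊆p : {x : Fin n} {p : Subset n} → x ∈ p → ⁅ x ⁆ ⊆ p
x∈p⇒⁅x⁆⊆p {x = x} {p} x∈p y∈ = subst (_∈ p) (sym (x∈⁅y⁆⇒x≡y x y∈)) x∈p

x∈p⇒1≤∣p∣ : {x : Fin n} {p : Subset n} → x ∈ p → 1 ≤ ∣ p ∣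
x∈p⇒1≤∣p∣ {x = x} {p} x∈p = subst (_≤ ∣ p ∣) (∣⁅x⁆∣≡1 x) (p⊆q⇒∣p∣≤∣q∣ (x∈p⇒⁅x⁆⊆p x∈p))

∣p∣≡1+k⇒nonempty : {p : Subset n} → ∣ p ∣ ≡ suc k → Nonempty p
∣p∣≡1+k⇒nonempty {n} {p = p} card with nonempty? p
... | yes p≢∅ = p≢∅
... | no  p≡∅ = contradiction (trans (sym card) (trans (cong ∣_∣ (Empty-unique p≡∅)) (∣⊥∣≡0 n))) λ ()

-- Images and preimages of subsets.

image : (Fin m → Fin n) → Subset m → Subset n
image f []            = ⊥
image f (inside ∷ p)  = ⁅ f zero ⁆ ∪ image (f ∘ suc) p
image f (outside ∷ p) = image (f ∘ suc) p

∈-image⁺ : (f : Fin m → Fin n) {p : Subset m} {x : Fin m} → x ∈ p → f x ∈ image f p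
∈-image⁺ f {inside ∷ p}  here        = x∈p∪q⁺ (inj₁ (x∈⁅x⁆ (f zero)))
∈-image⁺ f {inside ∷ p}  (there x∈p) = x∈p∪q⁺ (inj₂ (∈-image⁺ (f ∘ suc) x∈p))
∈-image⁺ f {outside ∷ p} (there x∈p) = ∈-image⁺ (f ∘ suc) x∈p

∈-image⁻ : (f : Fin m → Fin n) (p : Subset m) {y : Fin n} → y ∈ image f p → ∃[ x ] x ∈ p × f x ≡ y
∈-image⁻ f []            y∈ = contradiction y∈ ∉⊥
∈-image⁻ f (outside ∷ p) y∈ with x , x∈p , eq ← ∈-image⁻ (f ∘ suc) p y∈ = suc x , there x∈p , eq
∈-image⁻ f (inside ∷ p)  y∈ with x∈p∪q⁻ ⁅ f zero ⁆ (image (f ∘ suc) p) y∈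
... | inj₁ y∈f0 = zero , here , sym (x∈⁅y⁆⇒x≡y (f zero) y∈f0)
... | inj₂ y∈im with x , x∈p , eq ← ∈-image⁻ (f ∘ suc) p y∈im = suc x , there x∈p , eq

∣image∣≤ : (f : Fin m → Fin n) (p : Subset m) → ∣ image f p ∣ ≤ ∣ p ∣
∣image∣≤ {n = n} f [] = ℕ.≤-reflexive (∣⊥∣≡0 n)
∣image∣≤ f (outside ∷ p) = ∣image∣≤ (f ∘ suc) p
∣image∣≤ f (inside ∷ p)  = ℕ.≤-trans (∣p∪q∣≤∣p∣+∣q∣ ⁅ f zero ⁆ _)
  (ℕ.+-mono-≤ (ℕ.≤-reflexive (∣⁅x⁆∣≡1 (f zero))) (∣image∣≤ (f ∘ suc) p))

image-∘ : (g : Fin m → Fin n) (f : Fin l → Fin m) (p : Subset l) → image g (image f p) ≡ image (g ∘ f) p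
image-∘ g f p = ⊆-antisym
  (λ z∈ → let y , y∈ , gy≡z = ∈-image⁻ g (image f p) z∈ ; x , x∈ , fx≡y = ∈-image⁻ f p y∈ in
    subst (_∈ image (g ∘ f) p) (trans (cong g fx≡y) gy≡z) (∈-image⁺ (g ∘ f) x∈))
  (λ z∈ → let x , x∈ , eq = ∈-image⁻ (g ∘ f) p z∈ in
    subst (_∈ image g (image f p)) eq (∈-image⁺ g (∈-image⁺ f x∈)))

image-cong : {f g : Fin m → Fin n} → (∀ x → f x ≡ g x) → (p : Subset m) → image f p ≡ image g p
image-cong f≗g []            = refl
image-cong f≗g (outside ∷ p) = image-cong (f≗g ∘ suc) p
image-cong f≗g (inside ∷ p)  = cong₂ (λ x q → ⁅ x ⁆ ∪ q) (f≗g zero) (image-cong (f≗g ∘ suc) p)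

image-⁅⁆ : (f : Fin m → Fin n) (x : Fin m) → image f ⁅ x ⁆ ≡ ⁅ f x ⁆
image-⁅⁆ f x = ⊆-antisym
  (λ y∈ → let z , z∈ , fz≡y = ∈-image⁻ f ⁅ x ⁆ y∈ in
    subst (_∈ ⁅ f x ⁆) (trans (cong f (sym (x∈⁅y⁆⇒x≡y x z∈))) fz≡y) (x∈⁅x⁆ (f x)))
  (λ y∈ → subst (_∈ image f ⁅ x ⁆) (sym (x∈⁅y⁆⇒x≡y (f x) y∈)) (∈-image⁺ f (x∈⁅x⁆ x)))

image-∪ : (f : Fin m → Fin n) (p q : Subset m) → image f (p ∪ q) ≡ image f p ∪ image f q
image-∪ f p q = ⊆-antisym
  (λ y∈ → let x , x∈ , eq = ∈-image⁻ f (p ∪ q) y∈ in subst (_∈ image f p ∪ image f q) eq (split x∈))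
  (λ y∈ → join (x∈p∪q⁻ (image f p) (image f q) y∈))
  where
  split : ∀ {x} → x ∈ p ∪ q → f x ∈ image f p ∪ image f q
  split x∈ with x∈p∪q⁻ p q x∈
  ... | inj₁ x∈p = x∈p∪q⁺ (inj₁ (∈-image⁺ f x∈p))
  ... | inj₂ x∈q = x∈p∪q⁺ (inj₂ (∈-image⁺ f x∈q))
  join : ∀ {y} → y ∈ image f p ⊎ y ∈ image f q → y ∈ image f (p ∪ q)
  join (inj₁ y∈) with x , x∈ , eq ← ∈-image⁻ f p y∈ =
    subst (_∈ image f (p ∪ q)) eq (∈-image⁺ f (x∈p∪q⁺ {p = p} {q = q} (inj₁ x∈)))
  join (inj₂ y∈) with x , x∈ , eq ← ∈-image⁻ f q y∈ =
    subst (_∈ image f (p ∪ q)) eq (∈-image⁺ f (x∈p∪q⁺ {p = p} {q = q} (inj₂ x∈)))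

preimage : (Fin m → Fin n) → Subset n → Subset m
preimage f q = tabulate (lookup q ∘ f)

∈-preimage⁺ : (f : Fin m → Fin n) (q : Subset n) {x : Fin m} → f x ∈ q → x ∈ preimage f q
∈-preimage⁺ f q {x} fx∈q = lookup⇒[]= x _ (trans (lookup∘tabulate (lookup q ∘ f) x) ([]=⇒lookup fx∈q))

∈-preimage⁻ : (f : Fin m → Fin n) (q : Subset n) {x : Fin m} → x ∈ preimage f q → f x ∈ q
∈-preimage⁻ f q {x} x∈ = lookup⇒[]= (f x) q (trans (sym (lookup∘tabulate (lookup q ∘ f) x)) ([]=⇒lookup x∈))

image-preimage : (f : Fin m → Fin n) (q : Subset n) → (∀ {y} → y ∈ q → ∃[ x ] f x ≡ y) →
                 image f (preimage f q) ≡ q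
image-preimage f q onto = ⊆-antisym
  (λ y∈ → let x , x∈ , eq = ∈-image⁻ f (preimage f q) y∈ in subst (_∈ q) eq (∈-preimage⁻ f q x∈))
  (λ y∈ → let x , eq = onto y∈ in
    subst (_∈ image f (preimage f q)) eq (∈-image⁺ f (∈-preimage⁺ f q (subst (_∈ q) (sym eq) y∈))))

module _ {f : Fin m → Fin n} (f-inj : Injective _≡_ _≡_ f) where

  ∈-image-injective : {p : Subset m} {x : Fin m} → f x ∈ image f p → x ∈ p
  ∈-image-injective {p} fx∈ with x′ , x′∈ , eq ← ∈-image⁻ f p fx∈ = subst (_∈ p) (f-inj eq) x′∈

  image-injective : {p q : Subset m} → image f p ≡ image f q → p ≡ q
  image-injective eq = ⊆-antisym
    (λ x∈ → ∈-image-injective (subst (f _ ∈_) eq (∈-image⁺ f x∈)))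
    (λ x∈ → ∈-image-injective (subst (f _ ∈_) (sym eq) (∈-image⁺ f x∈)))

∣image∣≡ : {f : Fin m → Fin n} → Injective _≡_ _≡_ f → (p : Subset m) → ∣ image f p ∣ ≡ ∣ p ∣
∣image∣≡ {n = n} f-inj [] = ∣⊥∣≡0 n
∣image∣≡ f-inj (outside ∷ p) = ∣image∣≡ (Fin.suc-injective ∘ f-inj) p
∣image∣≡ {f = f} f-inj (inside ∷ p) =
  trans (x∉p⇒∣⁅x⁆∪p∣≡1+∣p∣ f0∉) (cong suc (∣image∣≡ (Fin.suc-injective ∘ f-inj) p))
  where
  f0∉ : f zero ∉ image (f ∘ suc) p
  f0∉ f0∈ with x , _ , eq ← ∈-image⁻ (f ∘ suc) p f0∈ with () ← f-inj eq

image-triple : (f : Fin m → Fin n) (x y z : Fin m) →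
  image f (⁅ x ⁆ ∪ ⁅ y ⁆ ∪ ⁅ z ⁆) ≡ ⁅ f x ⁆ ∪ ⁅ f y ⁆ ∪ ⁅ f z ⁆
image-triple f x y z = trans (image-∪ f ⁅ x ⁆ (⁅ y ⁆ ∪ ⁅ z ⁆)) (cong₂ _∪_ (image-⁅⁆ f x)
  (trans (image-∪ f ⁅ y ⁆ ⁅ z ⁆) (cong₂ _∪_ (image-⁅⁆ f y) (image-⁅⁆ f z))))

-- Unions of decompositions and images of cycles.

module _ .{{_ : NonZero k}} where

  contained-mono : {H H′ : Hypergraph n} {Cs : List (Cycle k n)} → H Pred.⊆ H′ →
    All (λ C → edges C Pred.⊆ H) Cs → All (λ C → edges C Pred.⊆ H′) Cs
  contained-mono H⊆H′ []               = []
  contained-mono H⊆H′ (C⊆H ∷ Cs⊆H) = (λ e∈ → H⊆H′ (C⊆H e∈)) ∷ contained-mono H⊆H′ Cs⊆H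

  decomposition-resp-≐ : {H H′ : Hypergraph n} {Cs : List (Cycle k n)} → H ≐ H′ →
    IsDecomposition H Cs → IsDecomposition H′ Cs
  decomposition-resp-≐ (H⊆H′ , H′⊆H) d = record
    { contained = contained-mono H⊆H′ contained
    ; disjoint  = disjoint
    ; covers    = λ e e∈ → covers e (H′⊆H e∈)
    } where open IsDecomposition d

  decomposition-∅ : IsDecomposition {v = n} Pred.∅ ([] {A = Cycle k n})
  decomposition-∅ = record { contained = [] ; disjoint = [] ; covers = λ _ () }

  decomposition-∪ : {H H′ : Hypergraph n} {Cs Cs′ : List (Cycle k n)} → H Pred.⊥ H′ →
    IsDecomposition H Cs → IsDecomposition H′ Cs′ → IsDecomposition (H Pred.∪ H′) (Cs ++ Cs′)
  decomposition-∪ {Cs = Cs} {Cs′} H⊥H′ d d′ = record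
    { contained = All.++⁺ (contained-mono inj₁ (contained d)) (contained-mono inj₂ (contained d′))
    ; disjoint  = AllPairs.++⁺ (disjoint d) (disjoint d′)
        (All.tabulate (λ C∈ → All.tabulate (λ D∈ → separate C∈ D∈)))
    ; covers    = λ e → [ (λ e∈ → Any.++⁺ˡ (covers d e e∈)) , (λ e∈ → Any.++⁺ʳ Cs (covers d′ e e∈)) ]′
    }
    where
    open IsDecomposition
    separate : ∀ {C D} → C List.∈ Cs → D List.∈ Cs′ → edges C Pred.⊥ edges D
    separate C∈ D∈ (e∈C , e∈D) = H⊥H′ (All.lookup (contained d) C∈ e∈C , All.lookup (contained d′) D∈ e∈D)

  mapCycle : (f : Fin m → Fin n) → Injective _≡_ _≡_ f → Cycle k m → Cycle k n
  mapCycle f f-inj C = record { vertex = f ∘ vertex ; distinct = distinct ∘ f-inj }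
    where open Cycle C

  image-edge : {f : Fin m → Fin n} (f-inj : Injective _≡_ _≡_ f) (C : Cycle k m) (i : Fin k) →
               image f (edge C i) ≡ edge (mapCycle f f-inj C) i
  image-edge {f = f} f-inj C i =
    image-triple f (vertex i) (vertex ((toℕ i + 1) mod k)) (vertex ((toℕ i + 2) mod k))
    where open Cycle C

-- Groups, shadows, and relabelling of groups.

-- Vertex 3g + j of Fin (n * 3) is the j-th element of group g.
shadow : Subset (n * 3) → Subset n
shadow {n} = image (quotient {n} 3)

Over : List (Subset n) → Hypergraph (n * 3)
Over L e = ∣ e ∣ ≡ 3 × shadow e List.∈ L

blowUp : (Fin m → Fin n) → Fin (m * 3) → Fin (n * 3)
blowUp {m} σ x = combine (σ (quotient {m} 3 x)) (remainder {m} 3 x)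

quotient-combine : (i : Fin n) (j : Fin 3) → quotient {n} 3 (combine i j) ≡ i
quotient-combine {n} i j = cong proj₁ (Fin.remQuot-combine {n} {3} i j)

combine-quotient-remainder : (x : Fin (n * 3)) → combine (quotient {n} 3 x) (remainder {n} 3 x) ≡ x
combine-quotient-remainder {n} = Fin.combine-remQuot {n} 3

module _ {σ : Fin m → Fin n} (σ-inj : Injective _≡_ _≡_ σ) where

  blowUp-injective : Injective _≡_ _≡_ (blowUp σ)
  blowUp-injective {x} {y} eq with eq₁ , eq₂ ← Fin.combine-injective _ _ _ _ eq =
    trans (sym (combine-quotient-remainder {m} x))
      (trans (cong₂ combine (σ-inj eq₁) eq₂) (combine-quotient-remainder {m} y))

  shadow-image : (e : Subset (m * 3)) → shadow {n} (image (blowUp σ) e) ≡ image σ (shadow {m} e)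
  shadow-image e = begin
    image (quotient {n} 3) (image (blowUp σ) e) ≡⟨ image-∘ _ _ e ⟩
    image (quotient {n} 3 ∘ blowUp σ) e         ≡⟨ image-cong (λ x → quotient-combine _ _) e ⟩
    image (σ ∘ quotient {m} 3) e                ≡⟨ image-∘ _ _ e ⟨
    image σ (shadow {m} e)                      ∎
    where open ≡-Reasoning

  -- Carries the two fixed designs to arbitrary distinct groups. For coverage, a triple with shadow
  -- `image σ S` has all its vertices in groups hit by `σ`, so it is the image of its preimage;
  -- injectivity of `image σ` shows that this preimage has shadow `S`.
  decomposition-blowUp : .{{_ : NonZero k}} {L : List (Subset m)} {Cs : List (Cycle k (m * 3))} →
    IsDecomposition (Over L) Cs →
    IsDecomposition (Over (map (image σ) L)) (map (mapCycle (blowUp σ) blowUp-injective) Cs)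
  decomposition-blowUp {k} {L} {Cs} d = record
    { contained = All.map⁺ (All.map (λ {C} → contained′ {C}) contained)
    ; disjoint  = AllPairs.map⁺ (AllPairs.map (λ {C} {D} → disjoint′ {C} {D}) disjoint)
    ; covers    = λ e e∈ → Any.map⁺ (covers′ e e∈)
    }
    where
    open IsDecomposition d
    f̂ = mapCycle {k} (blowUp σ) blowUp-injective
    contained′ : ∀ {C} → edges C Pred.⊆ Over L → edges (f̂ C) Pred.⊆ Over (map (image σ) L)
    contained′ {C} C⊆ (i , refl) rewrite sym (image-edge blowUp-injective C i)
      with card , sh ← C⊆ (i , refl) =
      trans (∣image∣≡ blowUp-injective (edge C i)) card ,
      subst (List._∈ map (image σ) L) (sym (shadow-image (edge C i))) (∈-map⁺ (image σ) sh)
    disjoint′ : ∀ {C D} → edges C Pred.⊥ edges D → edges (f̂ C) Pred.⊥ edges (f̂ D)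
    disjoint′ {C} {D} C⊥D {e} ((i , e≡) , (j , e≡′)) = C⊥D ((i , refl) , (j ,
      image-injective blowUp-injective (begin
      image (blowUp σ) (edge C i) ≡⟨ image-edge blowUp-injective C i ⟩
      edge (f̂ C) i                ≡⟨ e≡ ⟨
      e                           ≡⟨ e≡′ ⟩
      edge (f̂ D) j                ≡⟨ image-edge blowUp-injective D j ⟨
      image (blowUp σ) (edge D j) ∎)))
      where open ≡-Reasoning
    covers′ : ∀ e → Over (map (image σ) L) e → Any (λ C → edges (f̂ C) e) Cs
    covers′ e (card , sh) with S , S∈L , eq ← ∈-map⁻ (image σ) sh =
      Any.map (λ {C} → lift {C}) (covers e₀ (card₀ , sh₀))
      where
      onto : ∀ {y} → y ∈ e → ∃[ x ] blowUp σ x ≡ y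
      onto {y} y∈e
        with i , _ , σi≡ ← ∈-image⁻ σ S (subst (quotient {n} 3 y ∈_) eq (∈-image⁺ (quotient {n} 3) y∈e)) =
        combine {m} i (remainder {n} 3 y) , trans
          (cong₂ combine (trans (cong σ (quotient-combine i (remainder {n} 3 y))) σi≡)
            (cong proj₂ (Fin.remQuot-combine {m} {3} i (remainder {n} 3 y))))
          (combine-quotient-remainder {n} y)
      e₀ = preimage (blowUp σ) e
      im≡ : image (blowUp σ) e₀ ≡ e
      im≡ = image-preimage (blowUp σ) e onto
      card₀ : ∣ e₀ ∣ ≡ 3
      card₀ = trans (sym (∣image∣≡ blowUp-injective e₀)) (trans (cong ∣_∣ im≡) card)
      sh₀ : shadow e₀ List.∈ L
      sh₀ = subst (List._∈ L) (image-injective σ-inj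
        (trans (sym eq) (trans (cong (shadow {n}) (sym im≡)) (shadow-image e₀)))) S∈L
      lift : ∀ {C} → edges C e₀ → edges (f̂ C) e
      lift {C} (i , e₀≡) = i ,
        trans (sym im≡) (trans (cong (image (blowUp σ)) e₀≡) (image-edge blowUp-injective C i))

-- The two base designs, checked by evaluation.

_≟ˢ_ : DecidableEquality (Subset n)
_≟ˢ_ = ≡-dec Bool._≟_

injective? : (xs : Vec (Fin n) k) → Dec (∀ i j → lookup xs i ≡ lookup xs j → i ≡ j)
injective? xs = Fin.all? λ i → Fin.all? λ j → (lookup xs i Fin.≟ lookup xs j) →-dec (i Fin.≟ j)

cycle : (xs : Vec (Fin n) k) {_ : True (injective? xs)} → Cycle k n
cycle xs {inj} = record { vertex = lookup xs ; distinct = toWitness inj _ _ }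

module _ .{{_ : NonZero k}} {H : Hypergraph n} (H? : Pred.Decidable H) (Cs : List (Cycle k n)) where

  contained? : Dec (All (λ C → ∀ i → H (edge C i)) Cs)
  contained? = All.all? (λ C → Fin.all? (λ i → H? (edge C i))) Cs

  disjoint? : Dec (AllPairs (λ C D → ∀ i j → ¬ edge C i ≡ edge D j) Cs)
  disjoint? = AllPairs.allPairs? (λ C D → Fin.all? λ i → Fin.all? λ j → ¬? (edge C i ≟ˢ edge D j)) Cs

  covered? : (e : Subset n) → Dec (Any (λ C → edges C e) Cs)
  covered? e = Any.any? (λ C → Fin.any? λ i → e ≟ˢ edge C i) Cs

  -- `anySubset?` decides existential claims over all subsets, so coverage is checked by refuting
  -- the existence of an uncovered edge.
  uncovered? : Dec (∃[ e ] H e × ¬ Any (λ C → edges C e) Cs)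
  uncovered? = anySubset? λ e → H? e ×-dec ¬? (covered? e)

  decideDecomposition : True contained? → True disjoint? → True (¬? uncovered?) → IsDecomposition H Cs
  decideDecomposition c d u = record
    { contained = All.map (λ { H-edge (i , refl) → H-edge i }) (toWitness c)
    ; disjoint  = AllPairs.map (λ { ≢ ((i , e≡) , (j , e≡′)) → ≢ i j (trans (sym e≡) e≡′) }) (toWitness d)
    ; covers    = λ e e∈ → decidable-stable (covered? e) λ ¬cov → toWitness u (e , e∈ , ¬cov)
    }

Over? : (L : List (Subset n)) → Pred.Decidable (Over L)
Over? L e = (∣ e ∣ ℕ.≟ 3) ×-dec (shadow e ∈ˡ? L)
  where open DecMembership _≟ˢ_ renaming (_∈?_ to _∈ˡ?_)

-- Each cycle alternates between the groups 0-2 and 3-5, and the three cycles differ by a rotation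
-- of the second group. Over the three cycles, each pair inside one group therefore flanks each
-- vertex of the other group exactly once.
doublets : List (Cycle 6 6)
doublets =
  cycle (# 0 ∷ # 3 ∷ # 1 ∷ # 4 ∷ # 2 ∷ # 5 ∷ []) ∷
  cycle (# 0 ∷ # 4 ∷ # 1 ∷ # 5 ∷ # 2 ∷ # 3 ∷ []) ∷
  cycle (# 0 ∷ # 5 ∷ # 1 ∷ # 3 ∷ # 2 ∷ # 4 ∷ []) ∷ []

doublets-decompose : IsDecomposition (Over {2} (⊤ ∷ [])) doublets
doublets-decompose = decideDecomposition (Over? {2} (⊤ ∷ [])) doublets _ _ _

-- Found by an exact-cover search. The parts of K_{3,3,6} are 0–2, 3–5 and 6–11;
-- the last one is the union of two groups.
triplets : List (Cycle 6 12)
triplets =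
  cycle (# 2 ∷ # 5 ∷ # 10 ∷ # 0 ∷ # 4 ∷ # 8 ∷ []) ∷
  cycle (# 1 ∷ # 5 ∷ # 7 ∷ # 0 ∷ # 3 ∷ # 10 ∷ []) ∷
  cycle (# 2 ∷ # 3 ∷ # 7 ∷ # 1 ∷ # 4 ∷ # 10 ∷ []) ∷
  cycle (# 2 ∷ # 5 ∷ # 9 ∷ # 0 ∷ # 4 ∷ # 7 ∷ []) ∷
  cycle (# 1 ∷ # 5 ∷ # 11 ∷ # 0 ∷ # 3 ∷ # 9 ∷ []) ∷
  cycle (# 2 ∷ # 5 ∷ # 6 ∷ # 0 ∷ # 4 ∷ # 11 ∷ []) ∷
  cycle (# 1 ∷ # 5 ∷ # 8 ∷ # 0 ∷ # 3 ∷ # 6 ∷ []) ∷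
  cycle (# 2 ∷ # 3 ∷ # 11 ∷ # 1 ∷ # 4 ∷ # 9 ∷ []) ∷
  cycle (# 2 ∷ # 3 ∷ # 8 ∷ # 1 ∷ # 4 ∷ # 6 ∷ []) ∷ []

triplets-shadows : List (Subset 4)
triplets-shadows = (inside ∷ inside ∷ inside ∷ outside ∷ []) ∷ (inside ∷ inside ∷ outside ∷ inside ∷ []) ∷ []

triplets-decompose : IsDecomposition (Over triplets-shadows) triplets
triplets-decompose = decideDecomposition (Over? triplets-shadows) triplets _ _ _

-- The semiring of finite multisets over a commutative monoid.

module _ {a} {A : Set a} {_∙_ : A → A → A} {ε : A} (isCommutativeMonoid : IsCommutativeMonoid _≡_ _∙_ ε) where

  private
    module M = IsCommutativeMonoid isCommutativeMonoid
    _⊛_ : List A → List A → List A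
    _⊛_ = cartesianProductWith _∙_

  ⊛-congʳ : ∀ xs {ys zs} → ys ↭ zs → xs ⊛ ys ↭ xs ⊛ zs
  ⊛-congʳ []       p = ↭-refl
  ⊛-congʳ (x ∷ xs) p = Perm.++⁺ (Perm.map⁺ (x ∙_) p) (⊛-congʳ xs p)

  -- `cartesianProductWith` recurses on its left factor; this is the expansion along the right
  -- factor, from which commutativity follows by induction.
  ⊛-∷ : ∀ ys x xs → ys ⊛ (x ∷ xs) ↭ map (_∙ x) ys ++ ys ⊛ xs
  ⊛-∷ []       x xs = ↭-refl
  ⊛-∷ (y ∷ ys) x xs = prep (y ∙ x) (begin
    map (y ∙_) xs ++ ys ⊛ (x ∷ xs)            ↭⟨ Perm.++⁺ˡ (map (y ∙_) xs) (⊛-∷ ys x xs) ⟩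
    map (y ∙_) xs ++ map (_∙ x) ys ++ ys ⊛ xs ↭⟨ Perm.++-assoc (map (y ∙_) xs) _ _ ⟨
    (map (y ∙_) xs ++ map (_∙ x) ys) ++ ys ⊛ xs ↭⟨ Perm.++⁺ʳ _ (Perm.++-comm (map (y ∙_) xs) _) ⟩
    (map (_∙ x) ys ++ map (y ∙_) xs) ++ ys ⊛ xs ↭⟨ Perm.++-assoc (map (_∙ x) ys) _ _ ⟩
    map (_∙ x) ys ++ map (y ∙_) xs ++ ys ⊛ xs ∎)
    where open PermutationReasoning

  ⊛-comm : ∀ xs ys → xs ⊛ ys ↭ ys ⊛ xs
  ⊛-comm []       ys = ↭-reflexive (sym (List.cartesianProductWith-zeroʳ _∙_ ys))
  ⊛-comm (x ∷ xs) ys = begin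
    map (x ∙_) ys ++ xs ⊛ ys ≡⟨ cong (_++ xs ⊛ ys) (List.map-cong (M.comm x) ys) ⟩
    map (_∙ x) ys ++ xs ⊛ ys ↭⟨ Perm.++⁺ˡ (map (_∙ x) ys) (⊛-comm xs ys) ⟩
    map (_∙ x) ys ++ ys ⊛ xs ↭⟨ ⊛-∷ ys x xs ⟨
    ys ⊛ (x ∷ xs)            ∎
    where open PermutationReasoning

  ⊛-cong : ∀ {ws xs ys zs} → ws ↭ xs → ys ↭ zs → ws ⊛ ys ↭ xs ⊛ zs
  ⊛-cong {ws} {xs} {ys} {zs} p q = begin
    ws ⊛ ys ↭⟨ ⊛-congʳ ws q ⟩
    ws ⊛ zs ↭⟨ ⊛-comm ws zs ⟩
    zs ⊛ ws ↭⟨ ⊛-congʳ zs p ⟩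
    zs ⊛ xs ↭⟨ ⊛-comm zs xs ⟩
    xs ⊛ zs ∎
    where open PermutationReasoning

  map-⊛ : ∀ x ys zs → map (x ∙_) ys ⊛ zs ≡ map (x ∙_) (ys ⊛ zs)
  map-⊛ x []       zs = refl
  map-⊛ x (y ∷ ys) zs = begin
    map ((x ∙ y) ∙_) zs ++ map (x ∙_) ys ⊛ zs      ≡⟨ cong₂ _++_ map-∙ (map-⊛ x ys zs) ⟩
    map (x ∙_) (map (y ∙_) zs) ++ map (x ∙_) (ys ⊛ zs) ≡⟨ List.map-++ (x ∙_) (map (y ∙_) zs) (ys ⊛ zs) ⟨
    map (x ∙_) (map (y ∙_) zs ++ ys ⊛ zs)          ∎
    where
    open ≡-Reasoning
    map-∙ : map ((x ∙ y) ∙_) zs ≡ map (x ∙_) (map (y ∙_) zs)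
    map-∙ = trans (List.map-cong (M.assoc x y) zs) (List.map-∘ zs)

  ⊛-assoc : ∀ xs ys zs → (xs ⊛ ys) ⊛ zs ≡ xs ⊛ (ys ⊛ zs)
  ⊛-assoc []       ys zs = refl
  ⊛-assoc (x ∷ xs) ys zs = trans (List.cartesianProductWith-distribʳ-++ _∙_ (map (x ∙_) ys) (xs ⊛ ys) zs)
    (cong₂ _++_ (map-⊛ x ys zs) (⊛-assoc xs ys zs))

  ⊛-identityˡ : ∀ xs → [ ε ] ⊛ xs ≡ xs
  ⊛-identityˡ xs = trans (List.++-identityʳ _) (trans (List.map-cong M.identityˡ xs) (List.map-id xs))

  -- The monoid semiring over the natural numbers. It lets the ring solver prove that two lists of
  -- subsets are permutations of each other.
  multisetSemiring : CommutativeSemiring a a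
  multisetSemiring = record
    { Carrier = List A ; _≈_ = _↭_ ; _+_ = _++_ ; _*_ = _⊛_ ; 0# = [] ; 1# = [ ε ]
    ; isCommutativeSemiring = isCommutativeSemiringˡ (record
      { +-isCommutativeMonoid = Perm.++-isCommutativeMonoid
      ; *-isCommutativeMonoid = isCommutativeMonoidˡ (record
        { isSemigroup = record
          { isMagma = record
            { isEquivalence = IsCommutativeMonoid.isEquivalence Perm.++-isCommutativeMonoid
            ; ∙-cong        = ⊛-cong
            }
          ; assoc = λ xs ys zs → ↭-reflexive (⊛-assoc xs ys zs)
          }
        ; identityˡ = λ xs → ↭-reflexive (⊛-identityˡ xs)
        ; comm = ⊛-comm
        })
      ; distribʳ = λ xs ys zs → ↭-reflexive (List.cartesianProductWith-distribʳ-++ _∙_ ys zs xs)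
      ; zeroˡ = λ _ → ↭-refl
      })
    }

-- Polynomials in the groups, and tilings.

infixr 7 _⊗_
_⊗_ : List (Subset n) → List (Subset n) → List (Subset n)
_⊗_ = cartesianProductWith _∪_

subsetSemiring : ℕ → CommutativeSemiring _ _
subsetSemiring n = multisetSemiring (∪-isCommutativeMonoid n)

⟨_⟩ : Fin n → List (Subset n)
⟨ x ⟩ = [ ⁅ x ⁆ ]

choose : ℕ → List (Fin n) → List (Subset n)
choose zero    xs       = [ ⊥ ]
choose (suc k) []       = []
choose (suc k) (x ∷ xs) = ⟨ x ⟩ ⊗ choose k xs ++ choose (suc k) xs

-- Written as an image so that it agrees definitionally both with the relabelled shadows in
-- `decomposition-blowUp` and with the nested unions ending in `⊥` that arise from products of
-- singletons.
⟪_⟫ : Vec (Fin n) k → Subset n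
⟪ xs ⟫ = image (lookup xs) ⊤

-- Lists of subsets, up to permutation, are polynomials: ++ is the sum, ⊗ the
-- product, and choose k xs is the k-th elementary symmetric polynomial. No
-- distinctness is required here: it follows later from the sizes and the
-- distinctness of the listed subsets.
data Tiled {n} : ℕ → List (Subset n) → Set where
  empty   : Tiled k []
  doublet : ∀ g h → Tiled 2 [ ⟪ g ∷ h ∷ [] ⟫ ]
  triplet : ∀ g h i j → Tiled 3 (⟪ g ∷ h ∷ i ∷ [] ⟫ ∷ ⟪ g ∷ h ∷ j ∷ [] ⟫ ∷ [])
  union   : ∀ {L M} → Tiled k L → Tiled k M → Tiled k (L ++ M)
  permute : ∀ {L M} → L ↭ M → Tiled k L → Tiled k M

-- Tilings of products of elementary symmetric polynomials.

module _ {n : ℕ} where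

  open SemiringSolver (subsetSemiring n)
  open CommutativeSemiring (subsetSemiring n) using () renaming (zeroʳ to ⊗-zeroʳ)

  tiled-zeroʳ : ∀ L → Tiled {n} k (L ⊗ [])
  tiled-zeroʳ L = permute (↭-sym (⊗-zeroʳ L)) empty

  choose₁-++ : ∀ (us ws : List (Fin n)) → choose 1 (us ++ ws) ↭ choose 1 us ++ choose 1 ws
  choose₁-++ []       ws = ↭-refl
  choose₁-++ (u ∷ us) ws = prep (⁅ u ⁆ ∪ ⊥) (choose₁-++ us ws)

  -- Like `choose₃-++`, the expansion of an elementary symmetric polynomial in two blocks of
  -- variables. The two pure terms come first, so that what remains is the list of shadows crossing
  -- between the blocks.
  choose₂-++ : ∀ (us ws : List (Fin n)) →
    choose 2 (us ++ ws) ↭ choose 2 us ++ choose 2 ws ++ choose 1 us ⊗ choose 1 ws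
  choose₂-++ []       ws = ↭-reflexive (sym (List.++-identityʳ _))
  choose₂-++ (u ∷ us) ws = ↭-trans
    (Perm.++⁺ (⊛-congʳ (∪-isCommutativeMonoid n) ⟨ u ⟩ (choose₁-++ us ws)) (choose₂-++ us ws))
    -- The constants here and below come from `choose`: `choose 1 (u ∷ us)` unfolds to
    -- `u :* con 1 :+ u₁`, and the solver terms have to match such unfoldings definitionally.
    (solve 5 (λ u u₁ u₂ w₁ w₂ →
        u :* (u₁ :+ w₁) :+ (u₂ :+ (w₂ :+ u₁ :* w₁)) :=
        (u :* u₁ :+ u₂) :+ (w₂ :+ (u :* con 1 :+ u₁) :* w₁))
      ↭-refl ⟨ u ⟩ (choose 1 us) (choose 2 us) (choose 1 ws) (choose 2 ws))

  choose₃-++ : ∀ (us ws : List (Fin n)) →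
    choose 3 (us ++ ws) ↭
    choose 3 us ++ choose 3 ws ++ choose 2 us ⊗ choose 1 ws ++ choose 2 ws ⊗ choose 1 us
  choose₃-++ []       ws = ↭-sym (↭-trans
    (Perm.++⁺ˡ (choose 3 ws) (⊗-zeroʳ (choose 2 ws)))
    (↭-reflexive (List.++-identityʳ _)))
  choose₃-++ (u ∷ us) ws = ↭-trans
    (Perm.++⁺ (⊛-congʳ (∪-isCommutativeMonoid n) ⟨ u ⟩ (choose₂-++ us ws)) (choose₃-++ us ws))
    (solve 7 (λ u u₁ u₂ u₃ w₁ w₂ w₃ →
        u :* (u₂ :+ (w₂ :+ u₁ :* w₁)) :+ (u₃ :+ (w₃ :+ (u₂ :* w₁ :+ w₂ :* u₁))) :=
        (u :* u₂ :+ u₃) :+ (w₃ :+ ((u :* u₁ :+ u₂) :* w₁ :+ w₂ :* (u :* con 1 :+ u₁))))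
      ↭-refl ⟨ u ⟩ (choose 1 us) (choose 2 us) (choose 3 us) (choose 1 ws) (choose 2 ws) (choose 3 ws))

  tiled-choose₁⊗choose₁ : ∀ (us ws : List (Fin n)) → Tiled 2 (choose 1 us ⊗ choose 1 ws)
  tiled-choose₁⊗choose₁ []       ws = empty
  tiled-choose₁⊗choose₁ (u ∷ us) ws = permute
    (solve 3 (λ u u₁ w₁ → u :* w₁ :+ u₁ :* w₁ := (u :* con 1 :+ u₁) :* w₁)
      ↭-refl ⟨ u ⟩ (choose 1 us) (choose 1 ws))
    (union (row ws) (tiled-choose₁⊗choose₁ us ws))
    where
    row : ∀ ws → Tiled 2 (⟨ u ⟩ ⊗ choose 1 ws)
    row []       = empty
    row (w ∷ ws) = permute
      (solve 3 (λ u w w₁ → u :* (w :* con 1) :+ u :* w₁ := u :* (w :* con 1 :+ w₁))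
        ↭-refl ⟨ u ⟩ ⟨ w ⟩ (choose 1 ws))
      (union (doublet u w) (row ws))

  tiled-choose₂ : ∀ (us : List (Fin n)) → Tiled 2 (choose 2 us)
  tiled-choose₂ []       = empty
  tiled-choose₂ (u ∷ us) = union
    (permute (solve 2 (λ u u₁ → (u :* con 1 :+ con 0) :* u₁ := u :* u₁) ↭-refl ⟨ u ⟩ (choose 1 us))
      (tiled-choose₁⊗choose₁ (u ∷ []) us))
    (tiled-choose₂ us)

  -- The building block: for each `u` in `us`, the term xu(g + h) is one triplet, with `x` and `u`
  -- the shared groups. The next two lemmas write other products with a factor g + h as sums of such
  -- terms.
  tiled-⟨⟩⊗⟨+⟩⊗choose₁ : ∀ x g h (us : List (Fin n)) → Tiled 3 (⟨ x ⟩ ⊗ (⟨ g ⟩ ++ ⟨ h ⟩) ⊗ choose 1 us)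
  tiled-⟨⟩⊗⟨+⟩⊗choose₁ x g h []       = empty
  tiled-⟨⟩⊗⟨+⟩⊗choose₁ x g h (u ∷ us) = permute
    (solve 5 (λ x g h u u₁ →
        x :* (u :* ((g :+ h) :* con 1)) :+ x :* ((g :+ h) :* u₁) :=
        x :* ((g :+ h) :* (u :* con 1 :+ u₁)))
      ↭-refl ⟨ x ⟩ ⟨ g ⟩ ⟨ h ⟩ ⟨ u ⟩ (choose 1 us))
    (union (triplet x u g h) (tiled-⟨⟩⊗⟨+⟩⊗choose₁ x g h us))

  tiled-⟨+⟩⊗choose₂ : ∀ g h (us : List (Fin n)) → Tiled 3 ((⟨ g ⟩ ++ ⟨ h ⟩) ⊗ choose 2 us)
  tiled-⟨+⟩⊗choose₂ g h []       = empty
  tiled-⟨+⟩⊗choose₂ g h (u ∷ us) = permute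
    (solve 5 (λ g h u u₁ u₂ →
        u :* ((g :+ h) :* u₁) :+ (g :+ h) :* u₂ := (g :+ h) :* (u :* u₁ :+ u₂))
      ↭-refl ⟨ g ⟩ ⟨ h ⟩ ⟨ u ⟩ (choose 1 us) (choose 2 us))
    (union (tiled-⟨⟩⊗⟨+⟩⊗choose₁ u g h us) (tiled-⟨+⟩⊗choose₂ g h us))

  tiled-⟨+⟩⊗choose₁⊗choose₁ : ∀ g h (us ws : List (Fin n)) →
    Tiled 3 ((⟨ g ⟩ ++ ⟨ h ⟩) ⊗ choose 1 us ⊗ choose 1 ws)
  tiled-⟨+⟩⊗choose₁⊗choose₁ g h []       ws = empty
  tiled-⟨+⟩⊗choose₁⊗choose₁ g h (u ∷ us) ws = permute
    (solve 5 (λ g h u u₁ w₁ →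
        u :* ((g :+ h) :* w₁) :+ (g :+ h) :* (u₁ :* w₁) := (g :+ h) :* ((u :* con 1 :+ u₁) :* w₁))
      ↭-refl ⟨ g ⟩ ⟨ h ⟩ ⟨ u ⟩ (choose 1 us) (choose 1 ws))
    (union (tiled-⟨⟩⊗⟨+⟩⊗choose₁ u g h ws) (tiled-⟨+⟩⊗choose₁⊗choose₁ g h us ws))

  -- An even number of groups makes e₁(ws) a sum of terms g + h, each of which is then multiplied by
  -- e₂(us).
  tiled-choose₂⊗choose₁-even : ∀ m (us ws : List (Fin n)) → length ws ≡ m * 2 →
    Tiled 3 (choose 2 us ⊗ choose 1 ws)
  tiled-choose₂⊗choose₁-even zero    us []           _  = tiled-zeroʳ (choose 2 us)
  tiled-choose₂⊗choose₁-even (suc m) us (g ∷ h ∷ ws) eq = permute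
    (solve 4 (λ g h u₂ w₁ → (g :+ h) :* u₂ :+ u₂ :* w₁ := u₂ :* (g :* con 1 :+ (h :* con 1 :+ w₁)))
      ↭-refl ⟨ g ⟩ ⟨ h ⟩ (choose 2 us) (choose 1 ws))
    (union (tiled-⟨+⟩⊗choose₂ g h us)
      (tiled-choose₂⊗choose₁-even m us ws (ℕ.suc-injective (ℕ.suc-injective eq))))

  -- The six pairs of {p, q, r, s} form the paths pq·pr, sp·sq and rs·rq.
  tiled-K₄⊗choose₁ : ∀ p q r s (us : List (Fin n)) →
    Tiled 3 (choose 2 (p ∷ q ∷ r ∷ s ∷ []) ⊗ choose 1 us)
  tiled-K₄⊗choose₁ p q r s us = permute
    (solve 5 (λ p q r s u₁ →
        (p :* ((q :+ r) :* u₁) :+ s :* ((p :+ q) :* u₁)) :+ r :* ((s :+ q) :* u₁) :=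
        (p :* (q :* con 1 :+ (r :* con 1 :+ (s :* con 1 :+ con 0))) :+
          (q :* (r :* con 1 :+ (s :* con 1 :+ con 0)) :+
          (r :* (s :* con 1 :+ con 0) :+ (s :* con 0 :+ con 0)))) :* u₁)
      ↭-refl ⟨ p ⟩ ⟨ q ⟩ ⟨ r ⟩ ⟨ s ⟩ (choose 1 us))
    (union (union (tiled-⟨⟩⊗⟨+⟩⊗choose₁ p q r us) (tiled-⟨⟩⊗⟨+⟩⊗choose₁ s p q us))
      (tiled-⟨⟩⊗⟨+⟩⊗choose₁ r s q us))

  -- The four triples pair up as pq(r + s) + rs(p + q).
  tiled-K₄ : ∀ (p q r s : Fin n) → Tiled 3 (choose 3 (p ∷ q ∷ r ∷ s ∷ []))
  tiled-K₄ p q r s = permute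
    (solve 4 (λ p q r s →
        p :* (q :* ((r :+ s) :* con 1)) :+ r :* (s :* ((p :+ q) :* con 1)) :=
        p :* (q :* (r :* con 1 :+ (s :* con 1 :+ con 0)) :+ (r :* (s :* con 1 :+ con 0) :+ (s :* con 0 :+ con 0))) :+
        (q :* (r :* (s :* con 1 :+ con 0) :+ (s :* con 0 :+ con 0)) :+
        (r :* (s :* con 0 :+ con 0) :+ (s :* con 0 :+ con 0))))
      ↭-refl ⟨ p ⟩ ⟨ q ⟩ ⟨ r ⟩ ⟨ s ⟩)
    (union (triplet p q r s) (triplet r s p q))

  -- Split off four groups K = {p, q, r, s}: then e₃(K + us) = e₃(K) + e₃(us) + e₂(K)e₁(us) +
  -- e₂(us)e₁(K), and each term is tiled. The recursion ends with `b` groups, too few for a triple;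
  -- with three groups left over, the number of triples would be odd.
  tiled-choose₃ : ∀ m b (us : List (Fin n)) → length us ≡ m * 4 + b → b < 3 → Tiled 3 (choose 3 us)
  tiled-choose₃ zero b us eq b<3 = short us (subst (_< 3) (sym eq) b<3)
    where
    short : ∀ us → length us < 3 → Tiled 3 (choose 3 us)
    short []               _ = empty
    short (_ ∷ [])         _ = empty
    short (_ ∷ _ ∷ [])     _ = empty
    short (_ ∷ _ ∷ _ ∷ us) (s≤s (s≤s (s≤s ())))
  tiled-choose₃ (suc m) b (p ∷ q ∷ r ∷ s ∷ us) eq b<3 = permute
    (↭-sym (choose₃-++ (p ∷ q ∷ r ∷ s ∷ []) us))
    (union (tiled-K₄ p q r s)
    (union (tiled-choose₃ m b us (ℕ.+-cancelˡ-≡ 4 _ _ eq) b<3)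
    (union (tiled-K₄⊗choose₁ p q r s us)
           -- The paired factor is the four groups split off, as two pairs, so `us` may have any
           -- length.
           (tiled-choose₂⊗choose₁-even 2 us (p ∷ q ∷ r ∷ s ∷ []) refl))))

  -- Again four groups K at a time, now inside e₂. Besides e₂(K)e₁(ws) this adds e₁(K)e₁(us)e₁(ws),
  -- where e₁(K) = (p + q) + (r + s). At most one group is left at the end, and there e₂ vanishes.
  tiled-choose₂⊗choose₁ : ∀ m b (us ws : List (Fin n)) → length us ≡ m * 4 + b → b < 2 →
    Tiled 3 (choose 2 us ⊗ choose 1 ws)
  tiled-choose₂⊗choose₁ zero b us ws eq b<2 = short us (subst (_< 2) (sym eq) b<2)
    where
    short : ∀ us → length us < 2 → Tiled 3 (choose 2 us ⊗ choose 1 ws)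
    short []           _ = empty
    short (_ ∷ [])     _ = empty
    short (_ ∷ _ ∷ us) (s≤s (s≤s ()))
  tiled-choose₂⊗choose₁ (suc m) b (p ∷ q ∷ r ∷ s ∷ us) ws eq b<2 = permute
    -- `k₂` stays opaque, since `tiled-K₄⊗choose₁` supplies its term as a whole; e₁ of the same four
    -- groups is written out to expose p + q and r + s.
    (↭-trans (solve 8 (λ k₂ u₂ p q r s u₁ w₁ →
        k₂ :* w₁ :+ (u₂ :* w₁ :+ ((p :+ q) :* (u₁ :* w₁) :+ (r :+ s) :* (u₁ :* w₁))) :=
        (k₂ :+ (u₂ :+ (p :* con 1 :+ (q :* con 1 :+ (r :* con 1 :+ (s :* con 1 :+ con 0)))) :* u₁)) :* w₁)
        ↭-refl (choose 2 (p ∷ q ∷ r ∷ s ∷ [])) (choose 2 us) ⟨ p ⟩ ⟨ q ⟩ ⟨ r ⟩ ⟨ s ⟩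
        (choose 1 us) (choose 1 ws))
      (⊛-cong (∪-isCommutativeMonoid n) (↭-sym (choose₂-++ (p ∷ q ∷ r ∷ s ∷ []) us))
        (↭-refl {x = choose 1 ws})))
    (union (tiled-K₄⊗choose₁ p q r s ws)
    (union (tiled-choose₂⊗choose₁ m b us ws (ℕ.+-cancelˡ-≡ 4 _ _ eq) b<2)
    (union (tiled-⟨+⟩⊗choose₁⊗choose₁ p q us ws) (tiled-⟨+⟩⊗choose₁⊗choose₁ r s us ws))))

-- Repetition-free lists and the subsets listed by `choose`.

unique-++⁻ : ∀ {a} {A : Set a} (xs : List A) {ys} → Unique (xs ++ ys) → Unique xs × Unique ys × Disjoint xs ys
unique-++⁻ []       ys!             = [] , ys! , λ ()
unique-++⁻ (x ∷ xs) (x∉ ∷ xys!) with xs! , ys! , xs#ys ← unique-++⁻ xs xys! =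
  All.++⁻ˡ xs x∉ ∷ xs! , ys! , λ where
    (here refl , y∈ys) → All.lookup (All.++⁻ʳ xs x∉) y∈ys refl
    (there x∈  , y∈ys) → xs#ys (x∈ , y∈ys)

unique-resp-↭ : ∀ {a} {A : Set a} {xs ys : List A} → xs ↭ ys → Unique xs → Unique ys
unique-resp-↭ {A = A} p = PermSetoid.Unique-resp-↭ (setoid A) (↭⇒↭ₛ p)

-- Injectivity is relative to `P` because adjoining `u`, the map used in `unique-choose`, is
-- injective only on subsets that avoid `u`.
unique-map⁺ : ∀ {a b p} {A : Set a} {B : Set b} {P : A → Set p} {f : A → B} →
  (∀ {x y} → P x → P y → f x ≡ f y → x ≡ y) → ∀ {xs} → All P xs → Unique xs → Unique (map f xs)
unique-map⁺ f-inj []         []         = []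
unique-map⁺ f-inj (px ∷ pxs) (x∉ ∷ xs!) =
  All.map⁺ (All.zipWith (λ (py , x≢y) fx≡fy → x≢y (f-inj px py fx≡fy)) (pxs , x∉)) ∷ unique-map⁺ f-inj pxs xs!

Within : List (Fin n) → Subset n → Set
Within us S = ∀ {x} → x ∈ S → x List.∈ us

-- With `∈-choose⁻-within` and `∈-choose⁻-card` this shows that, for repetition-free `us`,
-- `choose k us` lists exactly the `k`-subsets of `us`. The induction removes the head from `S` if
-- it lies there.
∈-choose⁺ : ∀ k (us : List (Fin n)) {S} → ∣ S ∣ ≡ k → Within us S → S List.∈ choose k us
∈-choose⁺ zero us {S} card _ = here (Empty-unique λ (x , x∈) → ℕ.<⇒≢ (x∈p⇒1≤∣p∣ x∈) (sym card))
∈-choose⁺ (suc k) [] card within = contradiction (within (proj₂ (∣p∣≡1+k⇒nonempty card))) λ ()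
∈-choose⁺ (suc k) (u ∷ us) {S} card within with u ∈? S
... | no u∉S = ∈-++⁺ʳ _ (∈-choose⁺ (suc k) us card λ {x} x∈ → tail x∈ (within x∈))
  where
  tail : ∀ {x} → x ∈ S → x List.∈ u ∷ us → x List.∈ us
  tail x∈ (here refl) = contradiction x∈ u∉S
  tail x∈ (there x∈us) = x∈us
... | yes u∈S = ∈-++⁺ˡ (subst (List._∈ ⟨ u ⟩ ⊗ choose k us) join
    (∈-cartesianProductWith⁺ _∪_ {xs = ⟨ u ⟩} (here refl)
      (∈-choose⁺ k us card′ λ {x} x∈ → tail x∈ (within (p─q⊆p S ⁅ u ⁆ x∈)))))
  where
  u∉S-u : u ∉ S - u
  -- If `u` were in `S - u`, removing it a second time would lower the size, yet removing twice is
  -- the same as removing once.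
  u∉S-u u∈ = ℕ.<⇒≢ (x∈p⇒∣p-x∣<∣p∣ u∈) (cong ∣_∣ (p─q─q≡p─q S ⁅ u ⁆))
  tail : ∀ {x} → x ∈ S - u → x List.∈ u ∷ us → x List.∈ us
  tail x∈ (here refl) = contradiction x∈ u∉S-u
  tail x∈ (there x∈us) = x∈us
  split : ∀ {x} → x ∈ S → x ∈ ⁅ u ⁆ ∪ (S - u)
  split {x} x∈ with x Fin.≟ u
  ... | yes refl = x∈p∪q⁺ (inj₁ (x∈⁅x⁆ u))
  ... | no x≢u   = x∈p∪q⁺ (inj₂ (x∈p∧x≢y⇒x∈p-y x∈ x≢u))
  join : ⁅ u ⁆ ∪ (S - u) ≡ S
  join = ⊆-antisym
    (λ x∈ → [ (λ x∈u → subst (_∈ S) (sym (x∈⁅y⁆⇒x≡y u x∈u)) u∈S) , p─q⊆p S ⁅ u ⁆ ]′ (x∈p∪q⁻ ⁅ u ⁆ (S - u) x∈))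
    split
  card′ : ∣ S - u ∣ ≡ k
  card′ = ℕ.suc-injective (trans (sym (x∉p⇒∣⁅x⁆∪p∣≡1+∣p∣ u∉S-u)) (trans (cong ∣_∣ join) card))

∈-choose⁻-within : ∀ k (us : List (Fin n)) {S} → S List.∈ choose k us → Within us S
∈-choose⁻-within zero    us (here refl) x∈ = contradiction x∈ ∉⊥
∈-choose⁻-within (suc k) (u ∷ us) S∈ x∈ with ∈-++⁻ (⟨ u ⟩ ⊗ choose k us) S∈
... | inj₂ S∈us = there (∈-choose⁻-within (suc k) us S∈us x∈)
... | inj₁ S∈u with _ , S′ , here refl , S′∈ , refl ← ∈-cartesianProductWith⁻ _∪_ ⟨ u ⟩ (choose k us) S∈u
  with x∈p∪q⁻ ⁅ u ⁆ S′ x∈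
... | inj₁ x∈u = here (x∈⁅y⁆⇒x≡y u x∈u)
... | inj₂ x∈S′ = there (∈-choose⁻-within k us S′∈ x∈S′)

∈-choose⁻-card : ∀ k {us : List (Fin n)} {S} → Unique us → S List.∈ choose k us → ∣ S ∣ ≡ k
∈-choose⁻-card {n} zero    {us} us! (here refl) = ∣⊥∣≡0 n
∈-choose⁻-card (suc k) {u ∷ us} (u∉ ∷ us!) S∈ with ∈-++⁻ (⟨ u ⟩ ⊗ choose k us) S∈
... | inj₂ S∈us = ∈-choose⁻-card (suc k) us! S∈us
... | inj₁ S∈u with _ , S′ , here refl , S′∈ , refl ← ∈-cartesianProductWith⁻ _∪_ ⟨ u ⟩ (choose k us) S∈u =
  trans (x∉p⇒∣⁅x⁆∪p∣≡1+∣p∣ λ u∈ → All.lookup u∉ (∈-choose⁻-within k us S′∈ u∈) refl)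
    (cong suc (∈-choose⁻-card k us! S′∈))

⁅x⁆∪-injective : {x : Fin n} {p q : Subset n} → x ∉ p → x ∉ q → ⁅ x ⁆ ∪ p ≡ ⁅ x ⁆ ∪ q → p ≡ q
⁅x⁆∪-injective {x = x} x∉p x∉q eq = ⊆-antisym (sub x∉p eq) (sub x∉q (sym eq))
  where
  sub : ∀ {p q} → x ∉ p → ⁅ x ⁆ ∪ p ≡ ⁅ x ⁆ ∪ q → p ⊆ q
  sub {p} {q} x∉p eq {y} y∈p with x∈p∪q⁻ ⁅ x ⁆ q (subst (y ∈_) eq (x∈p∪q⁺ (inj₂ y∈p)))
  ... | inj₁ y∈x = contradiction (subst (_∈ p) (x∈⁅y⁆⇒x≡y x y∈x) y∈p) x∉p
  ... | inj₂ y∈q = y∈q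

unique-choose : ∀ k {us : List (Fin n)} → Unique us → Unique (choose k us)
unique-choose zero    us!  = [] ∷ []
unique-choose (suc k) []   = []
unique-choose (suc k) {u ∷ us} (u∉ ∷ us!) = Unique.++⁺
  (subst Unique (sym (List.++-identityʳ _))
    (unique-map⁺ ⁅x⁆∪-injective (All.tabulate (λ S∈ → u∉us k S∈)) (unique-choose k us!)))
  (unique-choose (suc k) us!)
  λ (S∈ , S∈′) → apart S∈ S∈′
  where
  u∉us : ∀ k {S} → S List.∈ choose k us → u ∉ S
  u∉us k S∈ u∈ = All.lookup u∉ (∈-choose⁻-within k us S∈ u∈) refl
  apart : ∀ {S} → S List.∈ ⟨ u ⟩ ⊗ choose k us → S List.∉ choose (suc k) us
  apart S∈ S∈′ with _ , S′ , here refl , _ , refl ← ∈-cartesianProductWith⁻ _∪_ ⟨ u ⟩ (choose k us) S∈ =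
    u∉us (suc k) S∈′ (x∈p∪q⁺ (inj₁ (x∈⁅x⁆ u)))

-- If the head recurred in the tail, the union would be one element too small. Thus the size of a
-- shadow yields the distinct groups that `decomposition-blowUp` requires.
∣⟪⟫∣≡⇒unique : (xs : Vec (Fin n) k) → ∣ ⟪ xs ⟫ ∣ ≡ k → UniqueVec xs
∣⟪⟫∣≡⇒unique []       _  = []
∣⟪⟫∣≡⇒unique {k = suc k} (x ∷ xs) eq =
  VecAll.lookup⁻ (λ i x≡ → x∉ (subst (_∈ ⟪ xs ⟫) (sym x≡) (∈-image⁺ (lookup xs) ∈⊤))) ∷
  ∣⟪⟫∣≡⇒unique xs (ℕ.suc-injective (trans (sym (x∉p⇒∣⁅x⁆∪p∣≡1+∣p∣ x∉)) eq))
  where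
  x∉ : x ∉ ⟪ xs ⟫
  x∉ x∈ = ℕ.<⇒≱ (ℕ.≤-reflexive (sym eq)) (ℕ.≤-trans
    (p⊆q⇒∣p∣≤∣q∣ λ y∈ → [ x∈p⇒⁅x⁆⊆p x∈ , (λ y∈ → y∈) ]′ (x∈p∪q⁻ ⁅ x ⁆ ⟪ xs ⟫ y∈))
    (ℕ.≤-trans (∣image∣≤ (lookup xs) ⊤) (ℕ.≤-reflexive (∣⊤∣≡n k))))

-- From tilings to cycle decompositions.

Decomposable : Hypergraph n → Set
Decomposable H = ∃[ Cs ] IsDecomposition {k = 6} H Cs

decomposable-∪ : {H H′ : Hypergraph n} → H Pred.⊥ H′ →
  Decomposable H → Decomposable H′ → Decomposable (H Pred.∪ H′)
decomposable-∪ H⊥H′ (_ , d) (_ , d′) = _ , decomposition-∪ H⊥H′ d d′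

decomposable-resp-≐ : {H H′ : Hypergraph n} → H ≐ H′ → Decomposable H → Decomposable H′
decomposable-resp-≐ H≐H′ (_ , d) = _ , decomposition-resp-≐ H≐H′ d

over-resp-↭ : {L M : List (Subset n)} → L ↭ M → Over L ≐ Over M
over-resp-↭ p = (λ (c , s) → c , Perm.∈-resp-↭ p s) , (λ (c , s) → c , Perm.∈-resp-↭ (↭-sym p) s)

over-++ : (L M : List (Subset n)) → Over L Pred.∪ Over M ≐ Over (L ++ M)
over-++ L M = [ (λ (c , s) → c , ∈-++⁺ˡ s) , (λ (c , s) → c , ∈-++⁺ʳ L s) ]′ ,
  λ (c , s) → [ (λ s∈ → inj₁ (c , s∈)) , (λ s∈ → inj₂ (c , s∈)) ]′ (∈-++⁻ L s)

-- Each tile becomes a relabelled base design. The sizes make the groups within a shadow distinct;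
-- that `i` and `j` differ in a triplet follows from its two shadows being different entries of a
-- repetition-free list. Uniqueness also makes the two sides of a `union` disjoint.
tiled⇒decomposable : {L : List (Subset n)} → Tiled k L → Unique L → All (λ S → ∣ S ∣ ≡ k) L →
  Decomposable (Over L)
tiled⇒decomposable empty _ _ = [] , decomposition-resp-≐ ((λ ()) , λ ()) decomposition-∅
tiled⇒decomposable (doublet g h) _ (card ∷ []) =
  _ , decomposition-blowUp (UniqueVec.lookup-injective (∣⟪⟫∣≡⇒unique (g ∷ h ∷ []) card) _ _)
    doublets-decompose
tiled⇒decomposable (triplet g h i j) ((S≢S′ ∷ []) ∷ _) (card ∷ card′ ∷ []) =
  _ , decomposition-blowUp (UniqueVec.lookup-injective ghij _ _) triplets-decompose
  where
  ghij : UniqueVec (g ∷ h ∷ i ∷ j ∷ [])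
  ghij with (g≢h ∷ g≢i ∷ []) ∷ (h≢i ∷ []) ∷ _ ← ∣⟪⟫∣≡⇒unique (g ∷ h ∷ i ∷ []) card
       with (_ ∷ g≢j ∷ []) ∷ (h≢j ∷ []) ∷ _ ← ∣⟪⟫∣≡⇒unique (g ∷ h ∷ j ∷ []) card′ =
    (g≢h ∷ g≢i ∷ g≢j ∷ []) ∷ (h≢i ∷ h≢j ∷ []) ∷
    ((λ { refl → S≢S′ refl }) ∷ []) ∷ [] ∷ []
tiled⇒decomposable (union {L = L} {M} s t) LM! cards with L! , M! , L#M ← unique-++⁻ L LM! =
  decomposable-resp-≐ (over-++ L M) (decomposable-∪ (λ ((_ , s) , (_ , s′)) → L#M (s , s′))
    (tiled⇒decomposable s L! (All.++⁻ˡ L cards)) (tiled⇒decomposable t M! (All.++⁻ʳ L cards)))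
tiled⇒decomposable (permute p t) M! cards = decomposable-resp-≐ (over-resp-↭ p)
  (tiled⇒decomposable t (unique-resp-↭ (↭-sym p) M!) (Perm.All-resp-↭ (↭-sym p) cards))

-- The 1-factor of groups, and the triples inside one half.

group : Fin n → Subset (n * 3)
group g = image (combine g) ⊤

∈-group⁺ : (x : Fin (n * 3)) → x ∈ group (quotient {n} 3 x)
∈-group⁺ {n} x = subst (_∈ group (quotient {n} 3 x)) (combine-quotient-remainder {n} x)
  (∈-image⁺ (combine (quotient {n} 3 x)) ∈⊤)

∈-group⁻ : {g : Fin n} {x : Fin (n * 3)} → x ∈ group g → quotient {n} 3 x ≡ g
∈-group⁻ {n} {g} x∈ with j , _ , refl ← ∈-image⁻ (combine g) ⊤ x∈ = quotient-combine g j

∣group∣≡3 : (g : Fin n) → ∣ group g ∣ ≡ 3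
∣group∣≡3 g = ∣image∣≡ (λ {i} {j} → Fin.combine-injectiveʳ g i g j) ⊤

∣shadow-group∣≤1 : (g : Fin n) → ∣ shadow {n} (group g) ∣ ≤ 1
∣shadow-group∣≤1 {n} g = subst (∣ shadow {n} (group g) ∣ ≤_) (∣⁅x⁆∣≡1 g) (p⊆q⇒∣p∣≤∣q∣ λ i∈ →
  let x , x∈ , eq = ∈-image⁻ (quotient {n} 3) (group g) i∈ in
  subst (_∈ ⁅ g ⁆) (trans (sym (∈-group⁻ x∈)) eq) (x∈⁅x⁆ g))

groups : List (Fin n) → List (Subset (n * 3))
groups = map group

-- The form taken by `V₁` and `V₂`; as a union of groups it has them as a 1-factor with `covers`
-- holding by `refl`.
cover : List (Fin n) → Subset (n * 3)
cover us = ⋃ (groups us)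

∈-cover⁺ : {us : List (Fin n)} {x : Fin (n * 3)} → quotient {n} 3 x List.∈ us → x ∈ cover us
∈-cover⁺ {n} {us = _ ∷ us} {x} (here refl) = x∈p∪q⁺ (inj₁ (∈-group⁺ {n} x))
∈-cover⁺ {us = u ∷ us} (there q∈)      = x∈p∪q⁺ {p = group u} (inj₂ (∈-cover⁺ q∈))

∈-cover⁻ : (us : List (Fin n)) {x : Fin (n * 3)} → x ∈ cover us → quotient {n} 3 x List.∈ us
∈-cover⁻ []       x∈ = contradiction x∈ ∉⊥
∈-cover⁻ (u ∷ us) x∈ with x∈p∪q⁻ (group u) (cover us) x∈
... | inj₁ x∈u  = here (∈-group⁻ x∈u)
... | inj₂ x∈us = there (∈-cover⁻ us x∈us)

cover-isOneFactor : {us : List (Fin n)} → Unique us → IsOneFactor (cover us) (groups us)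
cover-isOneFactor {us = us} us! = record
  { triples  = All.map⁺ (All.universal ∣group∣≡3 us)
  ; disjoint = AllPairs.map⁺ (AllPairs.map (λ {g} {h} g≢h (x , x∈) →
      let x∈g , x∈h = x∈p∩q⁻ (group g) (group h) x∈ in
      g≢h (trans (sym (∈-group⁻ x∈g)) (∈-group⁻ x∈h))) us!)
  ; covers   = refl
  }

∣cover∣≡ : {us : List (Fin n)} → Unique us → ∣ cover us ∣ ≡ length us * 3
∣cover∣≡ {n}                []         = ∣⊥∣≡0 (n * 3)
∣cover∣≡ {us = u ∷ us} (u∉ ∷ us!) = trans
  (disjoint⇒∣p∪q∣≡∣p∣+∣q∣ (group u) (cover us) λ (x , x∈) → let x∈u , x∈us = x∈p∩q⁻ (group u) (cover us) x∈ in
    All.lookup u∉ (∈-cover⁻ us x∈us) (sym (∈-group⁻ x∈u)))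
  (cong₂ _+_ (∣group∣≡3 u) (∣cover∣≡ us!))

within⁺ : {us : List (Fin n)} {e : Subset (n * 3)} → e ⊆ cover us → Within us (shadow {n} e)
within⁺ {n} {us} {e} e⊆ i∈ with x , x∈ , refl ← ∈-image⁻ (quotient {n} 3) e i∈ = ∈-cover⁻ us (e⊆ x∈)

within⁻ : {us : List (Fin n)} {e : Subset (n * 3)} → Within us (shadow {n} e) → e ⊆ cover us
within⁻ {n} within x∈ = ∈-cover⁺ (within (∈-image⁺ (quotient {n} 3) x∈))

-- A triple with a one-element shadow lies in a group, and both have three elements.
shadow-cases : (e : Subset (n * 3)) → ∣ e ∣ ≡ 3 →
  (∃[ g ] g ∈ shadow {n} e × e ≡ group g) ⊎ ∣ shadow {n} e ∣ ≡ 2 ⊎ ∣ shadow {n} e ∣ ≡ 3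
shadow-cases {n} e card = cases ∣ shadow {n} e ∣ refl
  (subst (∣ shadow {n} e ∣ ≤_) card (∣image∣≤ (quotient {n} 3) e))
  where
  x∃ = ∣p∣≡1+k⇒nonempty {p = e} card
  g = quotient {n} 3 (proj₁ x∃)
  g∈ : g ∈ shadow {n} e
  g∈ = ∈-image⁺ (quotient {n} 3) (proj₂ x∃)
  cases : ∀ s → ∣ shadow {n} e ∣ ≡ s → s ≤ 3 →
    (∃[ g ] g ∈ shadow {n} e × e ≡ group g) ⊎ ∣ shadow {n} e ∣ ≡ 2 ⊎ ∣ shadow {n} e ∣ ≡ 3
  cases 0 eq _ = contradiction (subst (1 ≤_) eq (x∈p⇒1≤∣p∣ g∈)) λ ()
  cases 1 eq _ = inj₁ (g , g∈ , p⊆q∧∣q∣≤∣p∣⇒p≡q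
    (λ {y} y∈ → subst (λ i → y ∈ group i)
      (x∈⁅y⁆⇒x≡y g (subst (quotient {n} 3 y ∈_) (sym shadow≡) (∈-image⁺ (quotient {n} 3) y∈)))
      (∈-group⁺ {n} y))
    (ℕ.≤-reflexive (trans (∣group∣≡3 g) (sym card))))
    where
    shadow≡ : ⁅ g ⁆ ≡ shadow {n} e
    shadow≡ = p⊆q∧∣q∣≤∣p∣⇒p≡q (x∈p⇒⁅x⁆⊆p g∈) (ℕ.≤-reflexive (trans eq (sym (∣⁅x⁆∣≡1 g))))
  cases 2 eq _ = inj₂ (inj₁ eq)
  cases 3 eq _ = inj₂ (inj₂ eq)
  cases (suc (suc (suc (suc s)))) _ (s≤s (s≤s (s≤s ())))

over-disjoint : ∀ {j k} {L M : List (Subset n)} → j ≢ k →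
  All (λ S → ∣ S ∣ ≡ j) L → All (λ S → ∣ S ∣ ≡ k) M → Over L Pred.⊥ Over M
over-disjoint j≢k cardL cardM ((_ , s∈L) , (_ , s∈M)) =
  j≢k (trans (sym (All.lookup cardL s∈L)) (All.lookup cardM s∈M))

choose-cards : ∀ k {us : List (Fin n)} → Unique us → All (λ S → ∣ S ∣ ≡ k) (choose k us)
choose-cards k us! = All.tabulate (∈-choose⁻-card k us!)

-- Removing the groups leaves the triples whose shadow has two or three elements. Shadows of size
-- two are tiled one by one, so only those of size three call for a hypothesis.
within-decomposable : {us : List (Fin n)} → Unique us → Tiled 3 (choose 3 us) →
  Decomposable (K³[ cover us ] without groups us)
within-decomposable {n} {us} us! tiled = decomposable-resp-≐ (to , from)
  (decomposable-∪ {H = Over (choose 2 us)} {Over (choose 3 us)}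
    (λ {e} → over-disjoint (λ ()) (choose-cards 2 us!) (choose-cards 3 us!) {e})
    (tiled⇒decomposable (tiled-choose₂ us) (unique-choose 2 us!) (choose-cards 2 us!))
    (tiled⇒decomposable tiled (unique-choose 3 us!) (choose-cards 3 us!)))
  where
  -- A shadow of at least two groups keeps `e` out of the 1-factor, whose members have shadows of
  -- size at most one.
  small : ∀ k {e} → 2 ≤ k → Over (choose k us) e → (K³[ cover us ] without groups us) e
  small k {e} 2≤k (card , s∈) = (card , within⁻ (∈-choose⁻-within k us s∈)) , λ e∈ →
    let g , _ , e≡ = ∈-map⁻ group e∈ in
    ℕ.<⇒≱ 2≤k (subst (_≤ 1) (∈-choose⁻-card k us! s∈)
      (subst (λ e → ∣ shadow {n} e ∣ ≤ 1) (sym e≡) (∣shadow-group∣≤1 {n} g)))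
  to : Over (choose 2 us) Pred.∪ Over (choose 3 us) Pred.⊆ (K³[ cover us ] without groups us)
  to (inj₁ over) = small 2 (s≤s (s≤s z≤n)) over
  to (inj₂ over) = small 3 (s≤s (s≤s z≤n)) over
  from : (K³[ cover us ] without groups us) Pred.⊆ Over (choose 2 us) Pred.∪ Over (choose 3 us)
  from {e} ((card , e⊆) , e∉) with shadow-cases {n} e card
  ... | inj₁ (g , g∈ , refl) = contradiction (∈-map⁺ group (within⁺ e⊆ g∈)) e∉
  ... | inj₂ (inj₁ card₂)    = inj₁ (card , ∈-choose⁺ 2 us card₂ (within⁺ e⊆))
  ... | inj₂ (inj₂ card₃)    = inj₂ (card , ∈-choose⁺ 3 us card₃ (within⁺ e⊆))

-- Triples crossing between the halves.

meets⇒¬within : {us ws : List (Fin n)} → Disjoint us ws → {e : Subset (n * 3)} →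
  Nonempty (e ∩ cover ws) → ¬ Within us (shadow {n} e)
meets⇒¬within {n} {ws = ws} us#ws {e} (x , x∈) within with x∈e , x∈c ← x∈p∩q⁻ e (cover ws) x∈ =
  us#ws (within (∈-image⁺ (quotient {n} 3) x∈e) , ∈-cover⁻ ws x∈c)

-- With `meets⇒¬within`, this turns meeting one half into a condition on the shadow: not being
-- contained in the other half.
¬within⇒meets : {us ws : List (Fin n)} → (∀ x → x List.∈ us ⊎ x List.∈ ws) → {e : Subset (n * 3)} →
  ¬ Within us (shadow {n} e) → Nonempty (e ∩ cover ws)
¬within⇒meets {n} {us} {ws} full {e} ¬within with nonempty? (e ∩ cover ws)
... | yes ne = ne
... | no ¬ne = contradiction (λ {i} → within⁺ e⊆ {i}) ¬within
  where
  e⊆ : e ⊆ cover us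
  e⊆ {x} x∈ with full (quotient {n} 3 x)
  ... | inj₁ q∈us = ∈-cover⁺ q∈us
  ... | inj₂ q∈ws = contradiction (x , x∈p∩q⁺ (x∈ , ∈-cover⁺ q∈ws)) ¬ne

module _ {us ws : List (Fin n)} (us+ws! : Unique (us ++ ws)) (full : ∀ x → x List.∈ us ++ ws) where

  private
    us! = proj₁ (unique-++⁻ us us+ws!)
    ws! = proj₁ (proj₂ (unique-++⁻ us us+ws!))

    us#ws : Disjoint us ws
    us#ws = proj₂ (proj₂ (unique-++⁻ us us+ws!))

  module _ (k : ℕ) {X : List (Subset n)} (split : choose k (us ++ ws) ↭ choose k us ++ choose k ws ++ X) where

    private
      whole! : Unique (choose k us ++ choose k ws ++ X)
      whole! = unique-resp-↭ split (unique-choose k us+ws!)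

      ws-part! : Unique (choose k ws ++ X)
      ws-part! = proj₁ (proj₂ (unique-++⁻ (choose k us) whole!))

    crossing-unique : Unique X
    crossing-unique = proj₁ (proj₂ (unique-++⁻ (choose k ws) ws-part!))

    crossing-cards : All (λ S → ∣ S ∣ ≡ k) X
    crossing-cards = All.++⁻ʳ (choose k ws) (All.++⁻ʳ (choose k us)
      (Perm.All-resp-↭ split (choose-cards k us+ws!)))

    -- A shadow inside one half would be listed both in the pure part of that half and in `X`,
    -- against the uniqueness of the whole list.
    over⇒crossing : Over X Pred.⊆ Crossing (cover us) (cover ws)
    over⇒crossing {e} (card , s∈) = card ,
      ¬within⇒meets (swap ∘ ∈-++⁻ us ∘ full) ¬within-ws ,
      ¬within⇒meets (∈-++⁻ us ∘ full) ¬within-us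
      where
      cardₛ = All.lookup crossing-cards s∈
      ¬within-us : ¬ Within us (shadow {n} e)
      ¬within-us within = proj₂ (proj₂ (unique-++⁻ (choose k us) whole!))
        (∈-choose⁺ k us cardₛ within , ∈-++⁺ʳ (choose k ws) s∈)
      ¬within-ws : ¬ Within ws (shadow {n} e)
      ¬within-ws within = proj₂ (proj₂ (unique-++⁻ (choose k ws) ws-part!))
        (∈-choose⁺ k ws cardₛ within , s∈)

    -- The whole list contains every `k`-set of groups, and a crossing shadow is in neither pure
    -- part, so it is in `X`.
    crossing⇒over : ∀ {e} → Crossing (cover us) (cover ws) e → ∣ shadow {n} e ∣ ≡ k → Over X e
    crossing⇒over {e} (card , meets-us , meets-ws) cardₛ
      with ∈-++⁻ (choose k us) (Perm.∈-resp-↭ split (∈-choose⁺ k (us ++ ws) cardₛ (λ {x} _ → full x)))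
    ... | inj₁ s∈us = contradiction (λ {x} → ∈-choose⁻-within k us s∈us {x}) (meets⇒¬within us#ws meets-ws)
    ... | inj₂ s∈ with ∈-++⁻ (choose k ws) s∈
    ... | inj₁ s∈ws = contradiction (λ {x} → ∈-choose⁻-within k ws s∈ws {x})
      (meets⇒¬within (λ (x∈ , x∈′) → us#ws (x∈′ , x∈)) meets-us)
    ... | inj₂ s∈X  = card , s∈X

  crossing-decomposable : Tiled 3 (choose 2 us ⊗ choose 1 ws) → Tiled 3 (choose 2 ws ⊗ choose 1 us) →
    Decomposable (Crossing (cover us) (cover ws))
  crossing-decomposable tiled tiled′ = decomposable-resp-≐ (to , from)
    (decomposable-∪ {H = Over X₂} {Over X₃}
      (λ {e} → over-disjoint (λ ()) (crossing-cards 2 split₂) (crossing-cards 3 split₃) {e})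
      (tiled⇒decomposable (tiled-choose₁⊗choose₁ us ws) (crossing-unique 2 split₂) (crossing-cards 2 split₂))
      (tiled⇒decomposable (union tiled tiled′) (crossing-unique 3 split₃) (crossing-cards 3 split₃)))
    where
    X₂ = choose 1 us ⊗ choose 1 ws
    X₃ = choose 2 us ⊗ choose 1 ws ++ choose 2 ws ⊗ choose 1 us
    split₂ = choose₂-++ us ws
    split₃ = choose₃-++ us ws
    to : Over X₂ Pred.∪ Over X₃ Pred.⊆ Crossing (cover us) (cover ws)
    to (inj₁ over) = over⇒crossing 2 split₂ over
    to (inj₂ over) = over⇒crossing 3 split₃ over
    from : Crossing (cover us) (cover ws) Pred.⊆ Over X₂ Pred.∪ Over X₃
    from {e} c@(card , meets-us , meets-ws) with shadow-cases {n} e card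
    ... | inj₂ (inj₁ card₂) = inj₁ (crossing⇒over 2 split₂ c card₂)
    ... | inj₂ (inj₂ card₃) = inj₂ (crossing⇒over 3 split₃ c card₃)
    -- A single group lies in one half and cannot cross.
    ... | inj₁ (g , _ , refl)
      with x , x∈ ← meets-us | y , y∈ ← meets-ws
      with x∈g , x∈us ← x∈p∩q⁻ (group g) (cover us) x∈ | y∈g , y∈ws ← x∈p∩q⁻ (group g) (cover ws) y∈ =
      contradiction
        ( subst (List._∈ us) (∈-group⁻ x∈g) (∈-cover⁻ us x∈us)
        , subst (List._∈ ws) (∈-group⁻ y∈g) (∈-cover⁻ ws y∈ws)) us#ws

  -- Assembling the two halves and the crossing triples.

  cover-disjoint : Empty (cover us ∩ cover ws)
  cover-disjoint (x , x∈) with x∈us , x∈ws ← x∈p∩q⁻ (cover us) (cover ws) x∈ =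
    us#ws (∈-cover⁻ us x∈us , ∈-cover⁻ ws x∈ws)

  cover-full : ∀ x → x ∈ cover us ⊎ x ∈ cover ws
  cover-full x with ∈-++⁻ us (full (quotient {n} 3 x))
  ... | inj₁ q∈ = inj₁ (∈-cover⁺ q∈)
  ... | inj₂ q∈ = inj₂ (∈-cover⁺ q∈)

  twoSplitDecomposition : length us * 3 ≡ n * 3 / 2 → length ws * 3 ≡ n * 3 / 2 →
    Tiled 3 (choose 3 us) → Tiled 3 (choose 3 ws) →
    Tiled 3 (choose 2 us ⊗ choose 1 ws) → Tiled 3 (choose 2 ws ⊗ choose 1 us) →
    Σ[ I ∈ List (Subset (n * 3)) ] Σ[ Cs ∈ List (Cycle 6 (n * 3)) ] IsTwoSplitDecomposition I Cs
  twoSplitDecomposition len-us len-ws tiled₁ tiled₂ tiled₁₂ tiled₂₁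
    with Cs₁ , d₁ ← within-decomposable us! tiled₁
       | Cs₂ , d₂ ← within-decomposable ws! tiled₂
       | Cs₁₂ , d₁₂ ← crossing-decomposable tiled₁₂ tiled₂₁ =
    groups us ++ groups ws , Cs₁ ++ Cs₂ ++ Cs₁₂ , record
    -- The groups of `us ++ ws` form a 1-factor of their cover, which is `⊤` because every group is
    -- listed.
    { isOneFactor = subst₂ IsOneFactor
        (⊆-antisym ⊆⊤ (λ {x} _ → ∈-cover⁺ (full (quotient {n} 3 x)))) (List.map-++ group us ws)
        (cover-isOneFactor us+ws!)
    ; isDecomposition = decomposition-resp-≐ (to , from)
        (decomposition-∪ within₁⊥ d₁ (decomposition-∪ within₂⊥ d₂ d₁₂))
    ; V₁ = cover us ; V₂ = cover ws
    ; disjoint = cover-disjoint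
    ; covers = ⊆-antisym ⊆⊤ (λ {x} _ → x∈p∪q⁺ (cover-full x))
    ; size₁ = trans (∣cover∣≡ us!) len-us
    ; size₂ = trans (∣cover∣≡ ws!) len-ws
    ; I₁ = groups us ; I₂ = groups ws
    ; isOneFactor₁ = cover-isOneFactor us!
    ; isOneFactor₂ = cover-isOneFactor ws!
    ; I-split = ↭-refl
    ; Cs₁ = Cs₁ ; Cs₂ = Cs₂ ; Cs₁₂ = Cs₁₂
    ; isDecomposition₁ = d₁
    ; isDecomposition₂ = d₂
    ; isDecomposition₁₂ = d₁₂
    ; Cs-split = ↭-refl
    }
    where
    H₁ H₂ H₁₂ H : Hypergraph (n * 3)
    H₁ = K³[ cover us ] without groups us
    H₂ = K³[ cover ws ] without groups ws
    H₁₂ = Crossing (cover us) (cover ws)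
    H = K³[ ⊤ ] without (groups us ++ groups ws)

    apart : ∀ {e} → e ⊆ cover us → ¬ Nonempty (e ∩ cover ws)
    apart {e} e⊆ (x , x∈) with x∈e , x∈ws ← x∈p∩q⁻ e (cover ws) x∈ =
      cover-disjoint (x , x∈p∩q⁺ (e⊆ x∈e , x∈ws))

    apart′ : ∀ {e} → e ⊆ cover ws → ¬ Nonempty (e ∩ cover us)
    apart′ {e} e⊆ (x , x∈) with x∈e , x∈us ← x∈p∩q⁻ e (cover us) x∈ =
      cover-disjoint (x , x∈p∩q⁺ (x∈us , e⊆ x∈e))

    meets : ∀ {e : Subset (n * 3)} {V} → ∣ e ∣ ≡ 3 → e ⊆ V → Nonempty (e ∩ V)
    meets card e⊆ with x , x∈ ← ∣p∣≡1+k⇒nonempty card = x , x∈p∩q⁺ (x∈ , e⊆ x∈)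

    group⊆ : ∀ vs {e} → e List.∈ groups vs → e ⊆ cover vs
    group⊆ vs e∈ x∈ with g , g∈ , refl ← ∈-map⁻ group e∈ =
      ∈-cover⁺ (subst (List._∈ vs) (sym (∈-group⁻ x∈)) g∈)

    within₂⊥ : H₂ Pred.⊥ H₁₂
    within₂⊥ (((_ , e⊆) , _) , (_ , meets-us , _)) = apart′ e⊆ meets-us

    within₁⊥ : H₁ Pred.⊥ (H₂ Pred.∪ H₁₂)
    within₁⊥ (((card , e⊆) , _) , inj₁ ((_ , e⊆′) , _)) = apart e⊆ (meets card e⊆′)
    within₁⊥ (((card , e⊆) , _) , inj₂ (_ , _ , meets-ws)) = apart e⊆ meets-ws

    to : H₁ Pred.∪ (H₂ Pred.∪ H₁₂) Pred.⊆ H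
    to (inj₁ ((card , e⊆) , e∉)) = (card , ⊆⊤) ,
      [ e∉ , (λ e∈ → apart e⊆ (meets card (group⊆ ws e∈))) ]′ ∘ ∈-++⁻ (groups us)
    to (inj₂ (inj₁ ((card , e⊆) , e∉))) = (card , ⊆⊤) ,
      [ (λ e∈ → apart (group⊆ us e∈) (meets card e⊆)) , e∉ ]′ ∘ ∈-++⁻ (groups us)
    to (inj₂ (inj₂ (card , meets-us , meets-ws))) = (card , ⊆⊤) ,
      [ (λ e∈ → apart (group⊆ us e∈) meets-ws) ,
        (λ e∈ → apart′ (group⊆ ws e∈) meets-us) ]′ ∘ ∈-++⁻ (groups us)

    from : H Pred.⊆ H₁ Pred.∪ (H₂ Pred.∪ H₁₂)
    from {e} ((card , _) , e∉) with nonempty? (e ∩ cover us) | nonempty? (e ∩ cover ws)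
    ... | yes m₁ | yes m₂ = inj₂ (inj₂ (card , m₁ , m₂))
    ... | no ¬m₁ | _      = inj₂ (inj₁ ((card , only-ws) , e∉ ∘ ∈-++⁺ʳ (groups us)))
      where
      only-ws : e ⊆ cover ws
      only-ws {x} x∈ = [ (λ x∈us → contradiction (x , x∈p∩q⁺ (x∈ , x∈us)) ¬m₁) , (λ x∈ws → x∈ws) ]′ (cover-full x)
    ... | yes _  | no ¬m₂ = inj₁ ((card , only-us) , e∉ ∘ ∈-++⁺ˡ)
      where
      only-us : e ⊆ cover us
      only-us {x} x∈ = [ (λ x∈us → x∈us) , (λ x∈ws → contradiction (x , x∈p∩q⁺ (x∈ , x∈ws)) ¬m₂) ]′ (cover-full x)

-- Equal halves and the residues of v modulo 24.

tiled-crossing : ∀ m b → b < 3 → (us ws : List (Fin n)) → length us ≡ m * 4 + b → length ws ≡ m * 4 + b →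
  Tiled 3 (choose 2 us ⊗ choose 1 ws)
tiled-crossing m 0 _ us ws len-us len-ws = tiled-choose₂⊗choose₁ m 0 us ws len-us (s≤s z≤n)
tiled-crossing m 1 _ us ws len-us len-ws = tiled-choose₂⊗choose₁ m 1 us ws len-us (s≤s (s≤s z≤n))
-- Now the number of pairs in `us` is odd, so the groups of `ws` are paired instead; their number is
-- 4m + 2 = 2(2m + 1).
tiled-crossing m 2 _ us ws len-us len-ws =
  tiled-choose₂⊗choose₁-even (m * 2 + 1) us ws (trans len-ws (even m))
  where
  even : ∀ m → m * 4 + 2 ≡ (m * 2 + 1) * 2
  even = solve-∀
tiled-crossing m (suc (suc (suc _))) (s≤s (s≤s (s≤s ())))

twoSplit : ∀ m b → b < 3 → let v = ((m * 4 + b) + (m * 4 + b)) * 3 in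
  Σ[ I ∈ List (Subset v) ] Σ[ Cs ∈ List (Cycle 6 v) ] IsTwoSplitDecomposition I Cs
twoSplit m b b<3 = twoSplitDecomposition {us = us} {ws}
  (subst Unique (sym us++ws) (Unique.allFin⁺ (t + t)))
  (λ x → subst (x List.∈_) (sym us++ws) (∈-allFin x))
  (trans (cong (_* 3) len-us) half) (trans (cong (_* 3) len-ws) half)
  (tiled-choose₃ m b us len-us b<3) (tiled-choose₃ m b ws len-ws b<3)
  (tiled-crossing m b b<3 us ws len-us len-ws) (tiled-crossing m b b<3 ws us len-ws len-us)
  where
  t = m * 4 + b
  us = take t (allFin (t + t))
  ws = drop t (allFin (t + t))
  us++ws : us ++ ws ≡ allFin (t + t)
  us++ws = List.take++drop≡id t (allFin (t + t))
  len : length (allFin (t + t)) ≡ t + t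
  len = List.length-tabulate {n = t + t} (λ x → x)
  len-us : length us ≡ t
  len-us = trans (List.length-take t (allFin (t + t))) (trans (cong (t ⊓_) len) (ℕ.m≤n⇒m⊓n≡m (ℕ.m≤m+n t t)))
  len-ws : length ws ≡ t
  len-ws = trans (List.length-drop t (allFin (t + t))) (trans (cong (_∸ t) len) (ℕ.m+n∸n≡m t t))
  half : t * 3 ≡ (t + t) * 3 / 2
  half = trans (sym (m*n/n≡m (t * 3) 2)) (cong (_/ 2) (double t))
    where
    double : ∀ t → t * 3 * 2 ≡ (t + t) * 3
    double = solve-∀

theorem17 : (v : ℕ) → (v % 24 ≡ 0 ⊎ v % 24 ≡ 6 ⊎ v % 24 ≡ 12) → 12 ≤ v →
    Σ[ I ∈ List (Subset v) ] Σ[ Cs ∈ List (Cycle 6 v) ] IsTwoSplitDecomposition I Cs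
theorem17 v v%24 _ = cases v%24
  where
  Goal : ℕ → Set
  Goal v = Σ[ I ∈ List (Subset v) ] Σ[ Cs ∈ List (Cycle 6 v) ] IsTwoSplitDecomposition I Cs
  -- For v = 24m + 6b there are 2(4m + b) groups of three, hence 4m + b in each half.
  from : ∀ b → b < 3 → v % 24 ≡ b * 6 → Goal v
  from b b<3 v% = subst Goal (sym v≡) (twoSplit (v / 24) b b<3)
    where
    regroup : ∀ m b → b * 6 + m * 24 ≡ ((m * 4 + b) + (m * 4 + b)) * 3
    regroup = solve-∀
    v≡ : v ≡ ((v / 24 * 4 + b) + (v / 24 * 4 + b)) * 3
    v≡ = trans (m≡m%n+[m/n]*n v 24) (trans (cong (_+ v / 24 * 24) v%) (regroup (v / 24) b))
  cases : v % 24 ≡ 0 ⊎ v % 24 ≡ 6 ⊎ v % 24 ≡ 12 → Goal v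
  cases (inj₁ v%)        = from 0 (s≤s z≤n) v%
  cases (inj₂ (inj₁ v%)) = from 1 (s≤s (s≤s z≤n)) v%
  cases (inj₂ (inj₂ v%)) = from 2 (s≤s (s≤s (s≤s z≤n))) v%
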